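{- Assume SETH-K-PH (stated in the context). For every $i\ge 1$, let $t_i$ be the time bound supplied by the assumption. Then: (1) (Explicitness.) The predicate $Q_i^{t_i}$ is an explicit language in $\Pi_{i+1}^p\setminus\mathbf{P}^{\Pi_i^p}$. In particular, it witnesses $\Pi_i^p\neq\Pi_{i+1}^p$. (2) (Density.) Its YES-set $\widehat R_i^{t_i}$ has density at least $1-n^{ -d}$ inside $\{0,1\}^n$; thus almost every length-$n$ string is a YES-instance. (3) (Sparse-side localization.) Every polynomial-time $\Pi_i^p$-oracle machine that is correct (as a decision procedure for $Q_i^{t_i}$) on all of $\widehat R_i^{t_i}\cap\{0,1\}^n$ for all sufficiently large $n$ must err, for infinitely many $n$, on some string of length $n$ in the sparse complement $\overline{\widehat R_i^{t_i}}$.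
   Context: Fix a constant $d\ge 3$. For every $i\ge 1$, fix a standard $\Pi_i^p$-complete language $L_i$ and a universal oracle machine $V^{(i)}$ with oracle access to $L_i$. For a polynomial time bound $t$, let $\widehat K_i^t(x)$ be the least length of a program that makes $V^{(i)}$ (with oracle $L_i$) output $x$ within $t(|x|)$ steps, let $\widehat R_i^t:=\{x:\widehat K_i^t(x)\ge |x|-d\log|x|\}$, and let $Q_i^t$ be the characteristic predicate of $\widehat R_i^t$ (also regarded as the language $\widehat R_i^t$). SETH-K-PH: for every $i\ge 1$, there exists a polynomial time bound $t_i$ such that $Q_i^{t_i}$ is not decidable by any polynomial-time Turing machine with oracle access to $\Pi_i^p$.
   Formalization: The logarithm in the threshold |x| − d log|x| is taken to base 2 and rounded up to an integer, in the assumption as well as in the conclusion; with an unrounded logarithm the density bound 1 − n^{ -d} can fail for some universal machines by up to a factor 2 in n^{ -d}. -}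

module Defs where

open import Level using (0ℓ) renaming (suc to lsuc)
open import Data.Bool using (Bool; true; false; not; if_then_else_)
import Data.Bool.Properties as Bool
open import Data.Empty using (⊥-elim)
open import Data.Fin using (Fin)
open import Data.Integer using (+_)
open import Data.List using (List; []; _∷_; _++_; map; length; foldr; filterᵇ)
import Data.List.Properties as List
open import Data.Maybe using (Maybe; just; nothing; Is-just)
import Data.Maybe.Relation.Unary.Any as MaybeAny
open import Data.Nat using (ℕ; zero; suc; _+_; _*_; _^_; _≤_; _<_; z≤n; _≤?_; NonZero)
open import Data.Nat.Logarithm using (⌈log₂_⌉)
open import Data.Nat.Properties
  using (m^n≢0; ≤-trans; ≤-antisym; m≤m+n; m≤n⇒m<n∨m≡n)
open import Data.Product using (Σ; ∃; ∃-syntax; _×_; _,_; proj₁; proj₂)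
open import Data.Rational.Unnormalised using (ℚᵘ; _/_)
open import Data.Sum using (_⊎_; inj₁; inj₂)
open import Data.Fin.Subset.Properties using (anySubset?)
open import Data.Unit using (tt)
open import Data.Vec as Vec using (Vec; []; _∷_; [_]; lookup; zipWith; replicate)
import Data.Vec.Properties as Vec
open import Function using (_∘_; _↔_; _⇔_)
open import Relation.Binary.PropositionalEquality using (_≡_; refl; sym; subst)
open import Relation.Nullary using (¬_; Dec; yes; no; does; _×-dec_)
open import Relation.Unary using (Pred; _∈_; _∉_)

Word : Set
Word = List Bool

-- Bool-valued, so that a language can serve as an oracle.  Every language of
-- the polynomial hierarchy is decidable, so none is lost this way.
Language : Set
Language = Word → Bool

Class : Set₂
Class = Pred Language (lsuc 0ℓ)

∅ : Language
∅ _ = false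

co : Language → Language
co A = not ∘ A

-- Coefficients, constant term first.
Poly : Set
Poly = List ℕ

⟦_⟧ : Poly → ℕ → ℕ
⟦ p ⟧ n = foldr (λ a r → a + n * r) 0 p

-- nothing is the blank.
Symbol : Set
Symbol = Maybe Bool

data Move : Set where
  left stay right : Move

-- A two-way infinite tape.  before lists the cells to the left of the head,
-- nearest first; all cells not listed are blank.
record Tape : Set where
  constructor tape
  field
    before : List Symbol
    here   : Symbol
    after  : List Symbol

open Tape public

blankTape : Tape
blankTape = tape [] nothing []

load : Word → Tape
load []      = blankTape
load (b ∷ w) = tape [] (just b) (map just w)

bits : List Symbol → Word
bits []             = []
bits (nothing ∷ _)  = []
bits (just b  ∷ ss) = b ∷ bits ss

-- The word written from the head rightwards, up to the first blank.
contents : Tape → Word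
contents T = bits (here T ∷ after T)

pop : List Symbol → Symbol × List Symbol
pop []       = nothing , []
pop (s ∷ ss) = s , ss

write : Symbol × Move → Tape → Tape
write (s , stay)  (tape ls _ rs) = tape ls s rs
write (s , left)  (tape ls _ rs) = tape (proj₂ (pop ls)) (proj₁ (pop ls)) (s ∷ rs)
write (s , right) (tape ls _ rs) = tape (s ∷ ls) (proj₁ (pop rs)) (proj₂ (pop rs))

data Instruction (State : Set) (k : ℕ) : Set where
  halt  : (accept : Bool) → Instruction State k
  query : (ifYes ifNo : State) → Instruction State k
  act   : (Vec Symbol k → State × Vec (Symbol × Move) k) → Instruction State k

-- Multitape oracle machines with m input words, given on the first m tapes.
-- A query asks about the contents of queryTape from its head onwards and leaves
-- the tapes unchanged; a function value is read off outTape in the same way.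
record Machine (m : ℕ) : Set₁ where
  field
    State     : Set
    size      : ℕ
    finite    : State ↔ Fin size
    work      : ℕ
    queryTape : Fin (m + work)
    outTape   : Fin (m + work)
    start     : State
    program   : State → Instruction State (m + work)

  record Config : Set where
    constructor config
    field
      state : State
      tapes : Vec Tape (m + work)

  open Config public

  initial : Vec Word m → Config
  initial xs = config start (Vec.map load xs Vec.++ replicate work blankTape)

  exec : Language → Instruction State (m + work) → Config → Config
  exec A (halt _)        c = c
  exec A (query q₁ q₀) c =
    config (if A (contents (lookup (tapes c) queryTape)) then q₁ else q₀) (tapes c)
  exec A (act δ)         c =
    let (q , ws) = δ (Vec.map here (tapes c))
    in config q (zipWith write ws (tapes c))

  step : Language → Config → Config
  step A c = exec A (program (state c)) c

  run : Language → ℕ → Config → Config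
  run A zero    c = c
  run A (suc s) c = run A s (step A c)

  verdict : Instruction State (m + work) → Maybe Bool
  verdict (halt b)    = just b
  verdict (query _ _) = nothing
  verdict (act _)     = nothing

  result : Config → Maybe Bool
  result c = verdict (program (state c))

  output : Config → Word
  output c = contents (lookup (tapes c) outTape)

module _ {m : ℕ} (M : Machine m) (A : Language) where
  open Machine M

  HaltsWithin : ℕ → Vec Word m → Set
  HaltsWithin s xs = Is-just (result (run A s (initial xs)))

  OutputsWithin : ℕ → Vec Word m → Word → Set
  OutputsWithin s xs y =
    HaltsWithin s xs × output (run A s (initial xs)) ≡ y

  Answers : Vec Word m → Bool → Set
  Answers xs b = ∃[ s ] result (run A s (initial xs)) ≡ just b

  PolyTime : Set
  PolyTime = ∃[ p ] ∀ xs → HaltsWithin (⟦ p ⟧ (Vec.sum (Vec.map length xs))) xs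

CorrectAt : Machine 1 → Language → Language → Word → Set
CorrectAt M A L x = Answers M A [ x ] (L x)

-- Machines without an oracle are those run with the oracle ∅.
P[_] : Language → Class
P[ A ] L = ∃[ M ] PolyTime M A × (∀ x → CorrectAt M A L x)

NP[_] : Language → Class
NP[ A ] L = Σ (Machine 2) λ M → PolyTime M A × ∃[ p ] (∀ x →
  L x ≡ true ⇔ (∃[ y ] length y ≤ ⟦ p ⟧ (length x) × Answers M A (x ∷ y ∷ []) true))

P^_ : Class → Class
(P^ C) L = ∃[ A ] A ∈ C × L ∈ P[ A ]

NP^_ : Class → Class
(NP^ C) L = ∃[ A ] A ∈ C × L ∈ NP[ A ]

Σᵖ : ℕ → Class
Σᵖ zero    = P[ ∅ ]
Σᵖ (suc i) = NP^ (Σᵖ i)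

Πᵖ : ℕ → Class
Πᵖ i L = co L ∈ Σᵖ i

_≤ₚ_ : Language → Language → Set₁
B ≤ₚ A = Σ (Word → Word) λ f → (∀ x → B x ≡ A (f x)) ×
  Σ (Machine 1) λ F → PolyTime F ∅ × (∀ x → ∃[ s ] OutputsWithin F ∅ s [ x ] (f x))

Complete : Class → Language → Set₁
Complete C A = A ∈ C × (∀ B → B ∈ C → B ≤ₚ A)

-- Each machine M is simulated, with polynomial overhead, by prefixing its
-- programs with a fixed word.
Universal : Machine 1 → Language → Set₁
Universal V A = ∀ (M : Machine 1) → ∃[ e ] ∃[ q ] ∀ p y →
  (∀ s → OutputsWithin M A s [ p ] y →
     OutputsWithin V A (⟦ q ⟧ (length p + s)) [ e ++ p ] y)
  × (∀ s → OutputsWithin V A s [ e ++ p ] y → ∃[ s′ ] OutputsWithin M A s′ [ p ] y)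

module Complexity (d : ℕ) (V : Machine 1) (A : Language) (t : Poly) where

  Produces : Word → Word → Set
  Produces p x = OutputsWithin V A (⟦ t ⟧ (length x)) [ p ] x

  -- K̂ x k holds when k is the least length of a program for x; no such k
  -- exists if x has no program, in which case the complexity is ∞.
  K̂ : Word → ℕ → Set
  K̂ x k = (∃[ p ] length p ≡ k × Produces p x) × (∀ p → Produces p x → k ≤ length p)

  -- K̂(x) ≥ |x| - d log |x|, with log rounded up to an integer (and log 0 = 0).
  -- Rounding down would break the density bound 1 - n^{-d}.  The subtraction is
  -- moved to the other side to avoid truncation.
  R̂ : Word → Set
  R̂ x = ∀ k → K̂ x k → length x ≤ k + d * ⌈log₂ length x ⌉

  produces? : ∀ p x → Dec (Produces p x)
  produces? p x = MaybeAny.dec (λ _ → yes tt) _ ×-dec List.≡-dec Bool._≟_ _ _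

  ofLength? : ∀ x k → Dec (∃[ p ] length p ≡ k × Produces p x)
  ofLength? x k with anySubset? {n = k} (λ v → produces? (Vec.toList v) x)
  ... | yes (v , h) = yes (Vec.toList v , Vec.length-toList v , h)
  ... | no ¬h = no λ { (p , refl , h) →
          ¬h (Vec.fromList p , subst (λ w → Produces w x) (sym (Vec.toList∘fromList p)) h) }

  -- Bounded search: either no program is shorter than b, or K̂ x has a value.
  search : ∀ x b → (∀ p → Produces p x → b ≤ length p) ⊎ ∃ (K̂ x)
  search x zero = inj₁ λ _ _ → z≤n
  search x (suc b) with search x b
  ... | inj₂ found = inj₂ found
  ... | inj₁ none with ofLength? x b
  ...   | yes h = inj₂ (b , h , none)
  ...   | no ¬h = inj₁ λ p h → longer p h (m≤n⇒m<n∨m≡n (none p h))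
    where
    longer : ∀ p → Produces p x → b < length p ⊎ b ≡ length p → suc b ≤ length p
    longer p h (inj₁ b<) = b<
    longer p h (inj₂ b≡) = ⊥-elim (¬h (p , sym b≡ , h))

  R̂? : ∀ x → Dec (R̂ x)
  R̂? x with search x (length x)
  ... | inj₁ none = yes λ { k ((p , refl , h) , _) → ≤-trans (none p h) (m≤m+n _ _) }
  ... | inj₂ (k , isK@((p , refl , h) , least))
        with length x ≤? k + d * ⌈log₂ length x ⌉
  ...   | no  ¬le = no λ r → ¬le (r k isK)
  ...   | yes le  = yes λ { k′ ((p′ , refl , h′) , least′) →
            subst (λ j → length x ≤ j + d * ⌈log₂ length x ⌉)
                  (≤-antisym (least p′ h′) (least′ p h)) le }

  Q : Language
  Q x = does (R̂? x)

SETH-K-PH : ℕ → (ℕ → Language) → (ℕ → Machine 1) → Set₁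
SETH-K-PH d L V =
  ∀ i → 1 ≤ i → ∃[ t ] Complexity.Q d (V i) (L i) t ∉ P^ (Πᵖ i)

words : ℕ → List Word
words zero    = [] ∷ []
words (suc n) = map (false ∷_) (words n) ++ map (true ∷_) (words n)

density : Language → ℕ → ℚᵘ
density A n = (+ length (filterᵇ A (words n))) / (2 ^ n)
  where instance _ = m^n≢0 2 n

1/_^_ : (n d : ℕ) .{{_ : NonZero n}} → ℚᵘ
1/ n ^ d = (+ 1) / (n ^ d)
  where instance _ = m^n≢0 n d

{-# OPTIONS --safe #-}
module Submission where

-- A word x lies outside R̂ exactly when some program p with |p| + d⌈log₂|x|⌉ < |x|
-- makes V output x within t(|x|) steps.  Guessing p and simulating V puts co Q in
-- NP relative to co L, which has the same power as the oracle L and lies in Σᵖ i.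
-- The verifier needs no arithmetic: |p| and the logarithm are spent as head moves
-- on a unary copy of x, ⌈log₂ n⌉ being the number of halvings of n that change it,
-- and the clock t is a nest of loops over further copies of x.
--
-- Density: distinct words outside R̂ of length n have distinct programs, of which
-- there are fewer than 2^(n - d⌈log₂ n⌉) ≤ 2^n / n^d.
--
-- Localization: a machine that errs only on finitely many words can be patched
-- at each of them, so one that is correct on R̂ and errs on only finitely many
-- lengths outside R̂ would put Q in P^(Πᵖ i).

-- The claims quantify over concrete multitape machines, so membership of `co Q` in NP is shown by
-- exhibiting one. A hand-written transition table would make correctness and timing unmanageable;
-- instead, commands with sequencing and loops get a big-step semantics indexed by a time bound, and
-- a single theorem, `simulate`, transfers derivations to compiled machines. The patched machines
-- are built in the same way. The oracle is complemented because `Πᵖ (suc i)` unfolds to NP over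
-- `Σᵖ i`, whereas `L i` lies in `Πᵖ i`, that is, `co (L i)` lies in `Σᵖ i`. The clock depends on x
-- only through |x|. Hence copies of 1ⁿ can drive it; and hence, for each n, the image of one
-- decoding function on short programs covers all words of length n outside R̂, which reduces
-- density to counting programs.

open import Defs
open import Level using (0ℓ)
open import Axiom.ExcludedMiddle using (ExcludedMiddle)
open import Data.Bool using (Bool; true; false; not; if_then_else_; _∧_; _∨_)
import Data.Bool.Properties as Bool
open import Data.Fin using (Fin; zero; suc; _↑ˡ_; _↑ʳ_)
import Data.Fin.Properties as Fin
import Data.Integer as ℤ
import Data.Integer.Properties as ℤ
import Data.Integer.Tactic.RingSolver as ℤ-Solver
open import Data.List as List using (List; []; _∷_; _++_; _ʳ++_; length; map; foldl; filterᵇ)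
import Data.List.Properties as List
open import Data.List.Membership.Propositional using () renaming (_∈_ to _∈ˡ_)
open import Data.List.Membership.Propositional.Properties
  using (∈-++⁺ˡ; ∈-++⁺ʳ; ∈-++⁻; ∈-map⁺; ∈-map⁻; ∈-∃++; ∈-filter⁻)
import Data.List.Relation.Unary.All as All
open import Data.List.Relation.Unary.AllPairs using ([]; _∷_)
open import Data.List.Relation.Unary.Any using () renaming (here to hereˡ; there to thereˡ)
open import Data.List.Relation.Unary.Unique.Propositional using (Unique)
import Data.List.Relation.Unary.Unique.Propositional.Properties as Unique
open import Data.Maybe using (Maybe; just; nothing; Is-just; is-just; is-nothing)
open import Data.Maybe.Properties using (just-injective)
open import Data.Maybe.Relation.Unary.Any using (just)
open import Data.Nat hiding (compare)
open import Data.Nat.Induction using (<-rec)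
open import Data.Nat.Logarithm using (⌈log₂_⌉; ⌈log₂⌉-mono-≤; ⌈log₂⌈n/2⌉⌉≡⌈log₂n⌉∸1; ⌈log₂2^n⌉≡n)
open import Data.Nat.Properties
open import Data.Nat.Tactic.RingSolver using (solve-∀)
open import Data.Product using (Σ; ∃-syntax; _×_; _,_; proj₁; proj₂)
open import Data.Product.Function.NonDependent.Propositional using (_×-↔_)
open import Data.Rational.Unnormalised as ℚ using (mkℚᵘ; 0ℚᵘ; 1ℚᵘ; *≤*; *<*)
import Data.Rational.Unnormalised.Properties as ℚ
open import Data.Sum using (_⊎_; inj₁; inj₂)
open import Data.Sum.Function.Propositional using (_⊎-↔_)
open import Data.Unit using (⊤; tt)
open import Data.Vec as Vec using (Vec; []; _∷_; [_]; lookup; zipWith; replicate; _[_]≔_)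
import Data.Vec.Properties as Vec
open import Data.Vec.Relation.Binary.Pointwise.Inductive as Pointwise using (Pointwise; []; _∷_)
open import Function using (_∘_; _↔_; _⇔_; mk⇔; Equivalence)
open import Function.Construct.Composition using (_↔-∘_)
open import Function.Construct.Symmetry using (↔-sym)
open import Relation.Binary.PropositionalEquality hiding ([_]; inspect)
open import Relation.Nullary using (¬_; Dec; does; yes; no; contradiction)
open import Relation.Unary using (_∈_; _∉_; _≐_)

-- Machines up to blanks at the ends of their tapes

-- A moving head leaves explicit blanks at the ends of the two lists of a tape,
-- so tapes are compared cell by cell.
cell : List Symbol → ℕ → Symbol
cell []       _       = nothing
cell (s ∷ ss) zero    = s
cell (s ∷ ss) (suc n) = cell ss n

record _≈_ (T T′ : Tape) : Set where
  constructor tape≈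
  field
    before≈ : cell (before T) ≗ cell (before T′)
    here≈   : here T ≡ here T′
    after≈  : cell (after T) ≗ cell (after T′)

open _≈_

≈-refl : ∀ {T} → T ≈ T
≈-refl = tape≈ (λ _ → refl) refl (λ _ → refl)

≈-trans : ∀ {T U W} → T ≈ U → U ≈ W → T ≈ W
≈-trans (tape≈ l h r) (tape≈ l′ h′ r′) =
  tape≈ (λ n → trans (l n) (l′ n)) (trans h h′) (λ n → trans (r n) (r′ n))

cell-pop₁ : ∀ ss → proj₁ (pop ss) ≡ cell ss 0
cell-pop₁ []       = refl
cell-pop₁ (s ∷ ss) = refl

cell-pop₂ : ∀ ss n → cell (proj₂ (pop ss)) n ≡ cell ss (suc n)
cell-pop₂ []       n = refl
cell-pop₂ (s ∷ ss) n = refl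

cell-pop : ∀ ss → cell (proj₁ (pop ss) ∷ proj₂ (pop ss)) ≗ cell ss
cell-pop ss zero    = cell-pop₁ ss
cell-pop ss (suc n) = cell-pop₂ ss n

pop₁-cong : ∀ ss ss′ → cell ss ≗ cell ss′ → proj₁ (pop ss) ≡ proj₁ (pop ss′)
pop₁-cong ss ss′ e = trans (cell-pop₁ ss) (trans (e 0) (sym (cell-pop₁ ss′)))

pop₂-cong : ∀ ss ss′ → cell ss ≗ cell ss′ →
            cell (proj₂ (pop ss)) ≗ cell (proj₂ (pop ss′))
pop₂-cong ss ss′ e n =
  trans (cell-pop₂ ss n) (trans (e (suc n)) (sym (cell-pop₂ ss′ n)))

∷-cong : ∀ s {ss ss′} → cell ss ≗ cell ss′ → cell (s ∷ ss) ≗ cell (s ∷ ss′)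
∷-cong s e zero    = refl
∷-cong s e (suc n) = e n

write-cong : ∀ a {T U} → T ≈ U → write a T ≈ write a U
write-cong (s , left) {T} {U} (tape≈ l h r) =
  tape≈ (pop₂-cong (before T) (before U) l) (pop₁-cong (before T) (before U) l) (∷-cong s r)
write-cong (s , stay) (tape≈ l h r) = tape≈ l refl r
write-cong (s , right) {T} {U} (tape≈ l h r) =
  tape≈ (∷-cong s l) (pop₁-cong (after T) (after U) r) (pop₂-cong (after T) (after U) r)

bits-cong : ∀ ss ss′ → cell ss ≗ cell ss′ → bits ss ≡ bits ss′
bits-cong []            []             e = refl
bits-cong []            (nothing ∷ _)  e = refl
bits-cong []            (just b ∷ _)   e with () ← e 0
bits-cong (nothing ∷ _) []             e = refl
bits-cong (just b ∷ _)  []             e with () ← e 0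
bits-cong (nothing ∷ _) (nothing ∷ _)  e = refl
bits-cong (nothing ∷ _) (just b ∷ _)   e with () ← e 0
bits-cong (just b ∷ _)  (nothing ∷ _)  e with () ← e 0
bits-cong (just b ∷ ss) (just c ∷ ss′) e with refl ← e 0 =
  cong (b ∷_) (bits-cong ss ss′ (e ∘ suc))

contents-cong : ∀ {T U} → T ≈ U → contents T ≡ contents U
contents-cong {T} {U} (tape≈ _ refl r) = bits-cong _ (here U ∷ after U) (∷-cong (here T) r)

infix 4 _≈*_
_≈*_ : ∀ {k} → Vec Tape k → Vec Tape k → Set
_≈*_ = Pointwise _≈_

≈*-refl : ∀ {k} {T : Vec Tape k} → T ≈* T
≈*-refl = Pointwise.refl ≈-refl

≈*-trans : ∀ {k} {T U W : Vec Tape k} → T ≈* U → U ≈* W → T ≈* W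
≈*-trans = Pointwise.trans ≈-trans

heres-cong : ∀ {k} {T U : Vec Tape k} → T ≈* U → Vec.map here T ≡ Vec.map here U
heres-cong []       = refl
heres-cong (e ∷ es) = cong₂ _∷_ (here≈ e) (heres-cong es)

writes-cong : ∀ {k} (ws : Vec _ k) {T U} → T ≈* U → zipWith write ws T ≈* zipWith write ws U
writes-cong []       []       = []
writes-cong (w ∷ ws) (e ∷ es) = write-cong w e ∷ writes-cong ws es

query-cong : ∀ {k} (A : Language) j {T U : Vec Tape k} → T ≈* U →
             A (contents (lookup T j)) ≡ A (contents (lookup U j))
query-cong A j e = cong A (contents-cong (Pointwise.lookup e j))

-- Runs, halting and uniqueness of verdicts

module _ {m : ℕ} (M : Machine m) (A : Language) where
  open Machine M

  infix 4 _≋_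
  _≋_ : Config → Config → Set
  c ≋ c′ = state c ≡ state c′ × tapes c ≈* tapes c′

  step-cong : ∀ {c c′} → c ≋ c′ → step A c ≋ step A c′
  step-cong {c} (refl , e) with program (state c)
  ... | halt _    = refl , e
  ... | query _ _ =
    cong (if_then _ else _) (query-cong A queryTape e) , e
  ... | act δ rewrite heres-cong e = refl , writes-cong _ e

  run-cong : ∀ s {c c′} → c ≋ c′ → run A s c ≋ run A s c′
  run-cong zero    e = e
  run-cong (suc s) e = run-cong s (step-cong e)

  run-+ : ∀ s s′ c → run A (s + s′) c ≡ run A s′ (run A s c)
  run-+ zero    s′ c = refl
  run-+ (suc s) s′ c = run-+ s s′ (step A c)

  step-halted : ∀ {c b} → result c ≡ just b → step A c ≡ c
  step-halted {c} e with program (state c)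
  ... | halt _ = refl

  run-halted : ∀ s {c b} → result c ≡ just b → run A s c ≡ c
  run-halted zero    e = refl
  run-halted (suc s) {c} e = trans (cong (run A s) (step-halted {c} e)) (run-halted s {c} e)

  -- Halting configurations are fixed by `step`, so the shorter of two runs already shows the
  -- verdict of the longer.
  run-result-unique : ∀ s s′ {c b b′} → result (run A s c) ≡ just b →
                      result (run A s′ c) ≡ just b′ → b ≡ b′
  run-result-unique zero    s′       {c} e e′ =
    just-injective (trans (sym e) (trans (cong result (sym (run-halted s′ {c} e))) e′))
  run-result-unique (suc s) zero     {c} e e′ =
    just-injective (trans (sym e) (trans (cong result (run-halted (suc s) {c} e′)) e′))
  run-result-unique (suc s) (suc s′) e e′ = run-result-unique s s′ e e′

  halts⇒result : ∀ {s xs} → HaltsWithin M A s xs →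
                 ∃[ b ] result (run A s (initial xs)) ≡ just b
  halts⇒result {s} {xs} h with result (run A s (initial xs))
  halts⇒result (just _) | just b = b , refl

  result⇒halts : ∀ {s s′ xs b} → s ≤ s′ → result (run A s (initial xs)) ≡ just b →
                 HaltsWithin M A s′ xs
  result⇒halts {s} {s′} {xs} {b} s≤s′ e =
    subst (λ c → Is-just (result c)) (sym stays) (subst Is-just (sym e) (just tt))
    where
    stays : run A s′ (initial xs) ≡ run A s (initial xs)
    stays = begin
      run A s′ (initial xs)                 ≡⟨ cong (λ k → run A k (initial xs)) (sym (m+[n∸m]≡n s≤s′)) ⟩
      run A (s + (s′ ∸ s)) (initial xs)     ≡⟨ run-+ s (s′ ∸ s) (initial xs) ⟩
      run A (s′ ∸ s) (run A s (initial xs)) ≡⟨ run-halted (s′ ∸ s) e ⟩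
      run A s (initial xs)                  ∎
      where open ≡-Reasoning

-- Finite state sets

Finite : Set → Set
Finite S = ∃[ n ] (S ↔ Fin n)

⊤-finite : Finite ⊤
⊤-finite = 1 , ↔-sym Fin.1↔⊤

Bool-finite : Finite Bool
Bool-finite = 2 , ↔-sym Fin.2↔Bool

⊎-finite : ∀ {S S′} → Finite S → Finite S′ → Finite (S ⊎ S′)
⊎-finite (m , f) (n , g) = m + n , (↔-sym Fin.+↔⊎ ↔-∘ (f ⊎-↔ g))

×-finite : ∀ {S S′} → Finite S → Finite S′ → Finite (S × S′)
×-finite (m , f) (n , g) = m * n , (↔-sym Fin.*↔× ↔-∘ (f ×-↔ g))

-- Structured programs, compiled into machines

-- A machine runs a program over k tapes with control points times G as states.
data Step (G : Set) (k : ℕ) : Set where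
  ask  : (ifYes ifNo : G) → Step G k
  move : (Vec Symbol k → G × Vec (Symbol × Move) k) → Step G k

infixr 5 _⨟_
data Cmd (G : Set) (k : ℕ) : Set where
  prim  : (G → Step G k) → Cmd G k
  _⨟_   : Cmd G k → Cmd G k → Cmd G k
  while : (Vec Symbol k → Bool) → Cmd G k → Cmd G k

keep : Symbol → Symbol × Move
keep s = s , stay

Ctl : ∀ {G k} → Cmd G k → Set
Ctl (prim _)    = ⊤
Ctl (c ⨟ d)     = Ctl c ⊎ Ctl d
Ctl (while _ c) = ⊤ ⊎ Ctl c

Ctl-finite : ∀ {G k} (c : Cmd G k) → Finite (Ctl c)
Ctl-finite (prim _)    = ⊤-finite
Ctl-finite (c ⨟ d)     = ⊎-finite (Ctl-finite c) (Ctl-finite d)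
Ctl-finite (while _ c) = ⊎-finite ⊤-finite (Ctl-finite c)

entry : ∀ {G k} (c : Cmd G k) → Ctl c
entry (prim _)    = tt
entry (c ⨟ d)     = inj₁ (entry c)
entry (while _ c) = inj₁ tt

codeStep : ∀ {G k S} → (G → S) → Step G k → Instruction S k
codeStep exit (ask g₁ g₀) = query (exit g₁) (exit g₀)
codeStep exit (move δ)    = act λ ss → exit (proj₁ (δ ss)) , proj₂ (δ ss)

-- Continuation style: `at` embeds the control points in the states of the host machine and `exit`
-- tells where control goes afterwards, so sequencing and looping only change these two functions.
code : ∀ {G k S} (c : Cmd G k) → (Ctl c → G → S) → (G → S) → Ctl c → G → Instruction S k
code (prim f)    at exit tt       g = codeStep exit (f g)
code (c ⨟ d)     at exit (inj₁ s) g = code c (at ∘ inj₁) (at (inj₂ (entry d))) s g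
code (c ⨟ d)     at exit (inj₂ s) g = code d (at ∘ inj₂) exit s g
code (while b c) at exit (inj₁ _) g = act λ ss →
  (if b ss then at (inj₂ (entry c)) g else exit g) , Vec.map keep ss
code (while b c) at exit (inj₂ s) g = code c (at ∘ inj₂) (at (inj₁ tt)) s g

module Semantics {G : Set} {k : ℕ} (A : Language) (q : Fin k) where

  St : Set
  St = G × Vec Tape k

  infix 4 _≈ˢ_
  _≈ˢ_ : St → St → Set
  (g , T) ≈ˢ (g′ , T′) = g ≡ g′ × T ≈* T′

  ≈ˢ-refl : ∀ {σ} → σ ≈ˢ σ
  ≈ˢ-refl = refl , ≈*-refl

  ≡⇒≈ˢ : ∀ {σ σ′} → σ ≡ σ′ → σ ≈ˢ σ′
  ≡⇒≈ˢ refl = ≈ˢ-refl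

  perform : Step G k → Vec Tape k → St
  perform (ask g₁ g₀) T = (if A (contents (lookup T q)) then g₁ else g₀) , T
  perform (move δ)    T = proj₁ (δ (Vec.map here T)) , zipWith write (proj₂ (δ (Vec.map here T))) T

  infix 3 _∶_⇒_[_]
  -- The index is an upper bound on the running time.
  data _∶_⇒_[_] : Cmd G k → St → St → ℕ → Set where
    prim  : ∀ {f g T} → prim f ∶ (g , T) ⇒ perform (f g) T [ 1 ]
    _⨟_   : ∀ {c d σ₁ σ₂ σ₃ m n} → c ∶ σ₁ ⇒ σ₂ [ m ] → d ∶ σ₂ ⇒ σ₃ [ n ] →
            c ⨟ d ∶ σ₁ ⇒ σ₃ [ m + n ]
    stop  : ∀ {b c g T} → b (Vec.map here T) ≡ false → while b c ∶ (g , T) ⇒ (g , T) [ 1 ]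
    again : ∀ {b c g T σ₂ σ₃ m n} → b (Vec.map here T) ≡ true →
            c ∶ (g , T) ⇒ σ₂ [ m ] → while b c ∶ σ₂ ⇒ σ₃ [ n ] →
            while b c ∶ (g , T) ⇒ σ₃ [ 1 + (m + n) ]
    -- All slack is collected in this rule: stray blanks, provable equalities of states, and raised
    -- time bounds.
    relax : ∀ {c σ σ₁ σ₁′ σ′ m n} → σ ≈ˢ σ₁ → σ₁′ ≈ˢ σ′ → m ≤ n →
            c ∶ σ₁ ⇒ σ₁′ [ m ] → c ∶ σ ⇒ σ′ [ n ]

keep-all : ∀ {k} (T : Vec Tape k) → zipWith write (Vec.map keep (Vec.map here T)) T ≡ T
keep-all []      = refl
keep-all (t ∷ T) = cong (t ∷_) (keep-all T)

module _ {m : ℕ} (M : Machine m) (A : Language) {G : Set} where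
  open Machine M
  open Semantics {G} A queryTape

  -- Induction on the derivation rather than on the command, since the last premise of `again`
  -- concerns the same loop. The hypothesis on `program` is pointwise, so that code embedded
  -- anywhere in a machine is covered.
  simulate : ∀ (c : Cmd G (m + work)) (at : Ctl c → G → State) (exit : G → State) →
             (∀ s g → program (at s g) ≡ code c at exit s g) →
             ∀ {g T g′ T′ n} → c ∶ (g , T) ⇒ (g′ , T′) [ n ] →
             ∃[ s ] s ≤ n × _≋_ M A (run A s (config (at (entry c) g) T)) (config (exit g′) T′)
  simulate c at exit coh (relax (refl , e) (refl , e′) m≤n r)
    with s , s≤m , q , r≈ ← simulate c at exit coh r
    with q₀ , r₀ ← run-cong M A s {config _ _} {config _ _} (refl , e) =
    s , ≤-trans s≤m m≤n , trans q₀ q , ≈*-trans r₀ (≈*-trans r≈ e′)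
  simulate (prim f) at exit coh {g} {T} prim = 1 , ≤-refl , one (f g) (coh tt g)
    where
    one : ∀ i → program (at tt g) ≡ codeStep exit i →
          _≋_ M A (step A (config (at tt g) T))
                  (config (exit (proj₁ (perform i T))) (proj₂ (perform i T)))
    one (ask g₁ g₀) e rewrite e with A (contents (lookup T queryTape))
    ... | true  = refl , ≈*-refl
    ... | false = refl , ≈*-refl
    one (move δ)    e rewrite e = refl , ≈*-refl
  simulate (c ⨟ d) at exit coh {g} {T} (r ⨟ r′)
    with s , s≤ , e ← simulate c (at ∘ inj₁) (at (inj₂ (entry d))) (coh ∘ inj₁) r
       | s′ , s′≤ , e′ ← simulate d (at ∘ inj₂) exit (coh ∘ inj₂) r′
    with q″ , e″ ← run-cong M A s′ e =
    s + s′ , +-mono-≤ s≤ s′≤ ,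
    subst (λ x → _≋_ M A x _) (sym (run-+ M A s s′ (config (at (inj₁ (entry c)) g) T)))
      (trans q″ (proj₁ e′) , ≈*-trans e″ (proj₂ e′))
  simulate (while b c) at exit coh {g} {T} (stop e) = 1 , ≤-refl , done
    where
    done : _≋_ M A (step A (config (at (inj₁ tt) g) T)) (config (exit g) T)
    done rewrite coh (inj₁ tt) g | e = refl , subst (_≈* T) (sym (keep-all T)) ≈*-refl
  simulate (while b c) at exit coh {g} {T} (again e r r′) =
    let s  , s≤  , c≋ = simulate c (at ∘ inj₂) (at (inj₁ tt)) (coh ∘ inj₂) r
        s′ , s′≤ , w≋ = simulate (while b c) at exit coh r′
        c≋′ = run-cong M A s go
        w≋′ = run-cong M A s′ (trans (proj₁ c≋′) (proj₁ c≋) , ≈*-trans (proj₂ c≋′) (proj₂ c≋))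
    in  suc (s + s′) , s≤s (+-mono-≤ s≤ s′≤) ,
        subst (λ x → _≋_ M A x _) (sym (run-+ M A s s′ (step A (config (at (inj₁ tt) g) T))))
          (trans (proj₁ w≋′) (proj₁ w≋) , ≈*-trans (proj₂ w≋′) (proj₂ w≋))
    where
    go : _≋_ M A (step A (config (at (inj₁ tt) g) T)) (config (at (inj₂ (entry c)) g) T)
    go rewrite coh (inj₁ tt) g | e = refl , subst (_≈* T) (sym (keep-all T)) ≈*-refl

mapStates : ∀ {S S′ k} → (S → S′) → Instruction S k → Instruction S′ k
mapStates f (halt b)      = halt b
mapStates f (query e₁ e₀) = query (f e₁) (f e₀)
mapStates f (act δ)       = act λ ss → f (proj₁ (δ ss)) , proj₂ (δ ss)

-- When c ends with memory g, the program tail takes over in its state exit g.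
module Assemble {m work : ℕ} {G E : Set} (finG : Finite G) (finE : Finite E)
                (q out : Fin (m + work)) (c : Cmd G (m + work)) (g₀ : G) (exit : G → E)
                (tail : E → Instruction E (m + work)) where

  machine : Machine m
  machine = record
    { State     = Ctl c × G ⊎ E
    ; size      = proj₁ fin
    ; finite    = proj₂ fin
    ; work      = work
    ; queryTape = q
    ; outTape   = out
    ; start     = inj₁ (entry c , g₀)
    ; program   = prog
    }
    where
    fin : Finite (Ctl c × G ⊎ E)
    fin = ⊎-finite (×-finite (Ctl-finite c) finG) finE
    prog : Ctl c × G ⊎ E → Instruction (Ctl c × G ⊎ E) (m + work)
    prog (inj₁ (s , g)) = code c (λ s g → inj₁ (s , g)) (inj₂ ∘ exit) s g
    prog (inj₂ e)       = mapStates inj₂ (tail e)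

  open Machine machine using (Config; config; initial; run; result)

  module _ (A : Language) where
    open Semantics {G} A q

    handover : ∀ {T₀ T g n} → c ∶ (g₀ , T₀) ⇒ (g , T) [ n ] → ∀ xs →
               Vec.map load xs Vec.++ replicate work blankTape ≡ T₀ →
               ∃[ s ] s ≤ n × _≋_ machine A (run A s (initial xs)) (config (inj₂ (exit g)) T)
    handover r xs refl =
      simulate machine A c (λ s g → inj₁ (s , g)) (inj₂ ∘ exit) (λ _ _ → refl) r

    answer : ∀ {T₀ T g n b} → c ∶ (g₀ , T₀) ⇒ (g , T) [ n ] → ∀ xs →
             Vec.map load xs Vec.++ replicate work blankTape ≡ T₀ → tail (exit g) ≡ halt b →
             ∃[ s ] s ≤ n × result (run A s (initial xs)) ≡ just b
    answer r xs e h with s , s≤ , st , _ ← handover r xs e = s , s≤ , result≡ s st h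
      where
      result≡ : ∀ s {e b} → Config.state (run A s (initial xs)) ≡ inj₂ e → tail e ≡ halt b →
                result (run A s (initial xs)) ≡ just b
      result≡ s st h rewrite st | h = refl

-- Loops along a tape

-- The tape whose head is on the first cell of r, with l to its left, nearest first.
at : List Symbol → List Symbol → Tape
at l r = tape l (proj₁ (pop r)) (proj₂ (pop r))

at-load : ∀ x → at [] (map just x) ≡ load x
at-load []      = refl
at-load (b ∷ x) = refl

at-cong : ∀ {l l′} r r′ → cell l ≗ cell l′ → cell r ≗ cell r′ → at l r ≈ at l′ r′
at-cong r r′ e e′ = tape≈ e (pop₁-cong r r′ e′) (pop₂-cong r r′ e′)

blanks-end : ∀ n → cell (nothing ∷ []) n ≡ cell [] n
blanks-end zero    = refl
blanks-end (suc n) = refl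

go : Move → Tape → Tape
go mv T = write (here T , mv) T

go-left : ∀ s l r → go left (at (s ∷ l) r) ≈ at l (s ∷ r)
go-left s l r = tape≈ (λ _ → refl) refl (cell-pop r)

go-left-edge : ∀ r → go left (at [] r) ≈ at [] (nothing ∷ r)
go-left-edge r = tape≈ (λ _ → refl) refl (cell-pop r)

writeAt : ∀ {k} → Fin k → Symbol × Move → Vec Symbol k → Vec (Symbol × Move) k
writeAt zero    a (s ∷ ss) = a ∷ Vec.map keep ss
writeAt (suc j) a (s ∷ ss) = keep s ∷ writeAt j a ss

local : ∀ {G k} → Fin k → (G → Symbol → G × Symbol × Move) → Cmd G k
local j f = prim λ g → move λ ss →
  proj₁ (f g (lookup ss j)) , writeAt j (proj₂ (f g (lookup ss j))) ss

update : ∀ {G k} → (G → Vec Symbol k → G) → Cmd G k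
update f = prim λ g → move λ ss → f g ss , Vec.map keep ss

shift : ∀ {G k} → Fin k → Move → Cmd G k
shift j mv = local j λ g s → g , s , mv

skip : ∀ {G k} → Cmd G k
skip = update λ g _ → g

repeat : ∀ {G k} → ℕ → Cmd G k → Cmd G k
repeat zero    c = skip
repeat (suc a) c = c ⨟ repeat a c

nonblank : ∀ {k} → Fin k → Vec Symbol k → Bool
nonblank j ss = is-just (lookup ss j)

-- The head may rest on the blank past the word, so a step left precedes the test. The loop ends on
-- the blank before the word, whence the final step right.
rewind : ∀ {G k} → Fin k → Cmd G k
rewind j = shift j left ⨟ while (nonblank j) (shift j left) ⨟ shift j right

-- Rewinding at the end makes the tape ready for the next traversal, so that such loops can be
-- nested.
each : ∀ {G k} → Fin k → Cmd G k → Cmd G k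
each j body = while (nonblank j) (body ⨟ shift j right) ⨟ rewind j

writeAt-writes : ∀ {k} (j : Fin k) a T →
  zipWith write (writeAt j a (Vec.map here T)) T ≡ T [ j ]≔ write a (lookup T j)
writeAt-writes zero    a (t ∷ T) = cong (write a t ∷_) (keep-all T)
writeAt-writes (suc j) a (t ∷ T) = cong (t ∷_) (writeAt-writes j a T)

-- T t is a family of tape vectors that differ only in tape j, which is t.
record Focus {k} (j : Fin k) (T : Tape → Vec Tape k) : Set where
  field
    look : ∀ t → lookup (T t) j ≡ t
    put  : ∀ t t′ → T t [ j ]≔ t′ ≡ T t′

open Focus

focus-here : ∀ {k} {j : Fin k} {T} → Focus j T → ∀ t → lookup (Vec.map here (T t)) j ≡ here t
focus-here {j = j} {T} F t = trans (Vec.lookup-map j here (T t)) (cong here (look F t))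

focus-write : ∀ {k} {j : Fin k} {T} → Focus j T → ∀ a t →
              zipWith write (writeAt j a (Vec.map here (T t))) (T t) ≡ T (write a t)
focus-write {j = j} {T} F a t =
  trans (writeAt-writes j a (T t)) (trans (cong (λ u → T t [ j ]≔ write a u) (look F t)) (put F t _))

[]≔-cong : ∀ {k} (T : Vec Tape k) j {t t′} → t ≈ t′ → T [ j ]≔ t ≈* T [ j ]≔ t′
[]≔-cong (_ ∷ T) zero    e = e ∷ ≈*-refl
[]≔-cong (t ∷ T) (suc j) e = ≈-refl ∷ []≔-cong T j e

focus-cong : ∀ {k} {j : Fin k} {T} → Focus j T → ∀ {t t′} → t ≈ t′ → T t ≈* T t′
focus-cong {j = j} {T} F {t} {t′} e =
  subst₂ _≈*_ (put F t t) (put F t t′) ([]≔-cong (T t) j e)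

iterate : ∀ {Z : Set} → ℕ → (Z → Z) → Z → Z
iterate zero    f z = z
iterate (suc n) f z = iterate n f (f z)

-- What a loop leaves on its own tape: in state z it replaces the letter b by `w z b` and goes on in
-- state `f z b`.
scan : ∀ {Z : Set} → (Z → Bool → Z) → (Z → Bool → Bool) → Z → Word → Word
scan f w z []      = []
scan f w z (b ∷ v) = w z b ∷ scan f w (f z b) v

length-scan : ∀ {Z : Set} (f : Z → Bool → Z) w z v → length (scan f w z v) ≡ length v
length-scan f w z []      = refl
length-scan f w z (b ∷ v) = cong suc (length-scan f w (f z b) v)

scan-id : ∀ {Z : Set} (f : Z → Bool → Z) z v → scan f (λ _ b → b) z v ≡ v
scan-id f z []      = refl
scan-id f z (b ∷ v) = cong (b ∷_) (scan-id f (f z b) v)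

foldl-iterate : ∀ {Z : Set} (f : Z → Z) z (v : Word) →
                foldl (λ z _ → f z) z v ≡ iterate (length v) f z
foldl-iterate f z []      = refl
foldl-iterate f z (b ∷ v) = foldl-iterate f (f z) v

-- Each letter costs the body, a test and a step right, and later a test and a step left; the final
-- 4 is the failing test of the sweep and the overhead 3 of `rewind`.
eachTime : ℕ → ℕ → ℕ
eachTime n τ = n * (τ + 4) + 4

module Loops {G : Set} {k : ℕ} (A : Language) (q : Fin k) where
  open Semantics {G} A q public

  local⇒ : ∀ {j T} → Focus j T → ∀ f {g t t′} → write (proj₂ (f g (here t))) t ≈ t′ →
           local j f ∶ (g , T t) ⇒ (proj₁ (f g (here t)) , T t′) [ 1 ]
  local⇒ {j} {T} F f {g} {t} e =
    relax ≈ˢ-refl (cong (λ s → proj₁ (f g s)) (focus-here F t) , written) ≤-refl prim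
    where
    written : zipWith write (writeAt j (proj₂ (f g (lookup (Vec.map here (T t)) j)))
                (Vec.map here (T t))) (T t) ≈* T _
    written rewrite focus-here F t =
      subst (_≈* T _) (sym (focus-write F (proj₂ (f g (here t))) t)) (focus-cong F e)

  shift⇒ : ∀ {j T} → Focus j T → ∀ mv {g t t′} → go mv t ≈ t′ →
           shift j mv ∶ (g , T t) ⇒ (g , T t′) [ 1 ]
  shift⇒ F mv = local⇒ F (λ g s → g , s , mv)

  update⇒ : ∀ f {g T} → update f ∶ (g , T) ⇒ (f g (Vec.map here T) , T) [ 1 ]
  update⇒ f {T = T} = relax ≈ˢ-refl (refl , subst (_≈* T) (sym (keep-all T)) ≈*-refl) ≤-refl prim

  skip⇒ : ∀ {σ} → skip ∶ σ ⇒ σ [ 1 ]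
  skip⇒ = update⇒ (λ g _ → g)

  repeat⇒ : ∀ {Z : Set} {c τ} (S : Z → St) (f : Z → Z) →
            (∀ z → c ∶ S z ⇒ S (f z) [ τ ]) →
            ∀ a z → repeat a c ∶ S z ⇒ S (iterate a f z) [ a * τ + 1 ]
  repeat⇒ S f body zero    z = skip⇒
  repeat⇒ {τ = τ} S f body (suc a) z =
    relax ≈ˢ-refl ≈ˢ-refl (≤-reflexive (sym (+-assoc τ (a * τ) 1)))
      (body z ⨟ repeat⇒ S f body a (f z))

  module _ {j : Fin k} {T : Tape → Vec Tape k} (F : Focus j T) {g : G} where

    returning : List Bool → List Symbol → Tape
    returning []      r = at [] (nothing ∷ r)
    returning (b ∷ u) r = at (map just u) (just b ∷ r)

    go-returning : ∀ u r → go left (at (map just u) r) ≈ returning u r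
    go-returning []      r = go-left-edge r
    go-returning (b ∷ u) r = go-left (just b) (map just u) r

    return-loop : ∀ u r → while (nonblank j) (shift j left) ∶
      (g , T (returning u r)) ⇒ (g , T (at [] (nothing ∷ (map just u ʳ++ r)))) [ length u * 2 + 1 ]
    return-loop []      r = stop (cong is-just (focus-here F _))
    return-loop (b ∷ u) r =
      again (cong is-just (focus-here F _)) (shift⇒ F left (go-returning u (just b ∷ r)))
            (return-loop u (just b ∷ r))

    rewind⇒ : ∀ u r → rewind j ∶
      (g , T (at (map just u) r)) ⇒ (g , T (at [] (map just u ʳ++ r))) [ length u * 2 + 3 ]
    rewind⇒ u r = relax ≈ˢ-refl ≈ˢ-refl (≤-reflexive (arith (length u * 2)))
      (shift⇒ F left (go-returning u r) ⨟ return-loop u r ⨟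
       -- The blank stepped over at the left end remains listed in `before`; `blanks-end` discards
       -- it.
       shift⇒ F right (at-cong rest rest blanks-end (λ _ → refl)))
      where
      rest = map just u ʳ++ r
      arith : ∀ n → 1 + (n + 1 + 1) ≡ n + 3
      arith = solve-∀

  -- `Z` is the state of the loop; the memory and all tapes other than j are functions of it, so one
  -- invariant describes bodies that change several tapes.
  module Each {Z : Set} {j : Fin k} {mem : Z → G} {T : Z → Tape → Vec Tape k}
              (F : ∀ z → Focus j (T z)) (f : Z → Bool → Z) (w : Z → Bool → Bool)
              {body : Cmd G k} {τ : ℕ} where

    Body : Set
    Body = ∀ z b l r → body ∶ (mem z , T z (at l (just b ∷ r))) ⇒
                              (mem (f z b) , T (f z b) (at l (just (w z b) ∷ r))) [ τ ]

    sweep : Body → ∀ z v u → while (nonblank j) (body ⨟ shift j right) ∶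
      (mem z , T z (at (map just u) (map just v))) ⇒
      (mem (foldl f z v) , T (foldl f z v) (at (map just (scan f w z v ʳ++ u)) []))
      [ length v * (τ + 2) + 1 ]
    sweep B z []      u = stop (cong is-just (focus-here (F z) _))
    sweep B z (b ∷ v) u = relax ≈ˢ-refl ≈ˢ-refl (≤-reflexive (arith τ (length v * (τ + 2))))
      (again (cong is-just (focus-here (F z) _))
        (B z b (map just u) (map just v) ⨟ shift⇒ (F (f z b)) right ≈-refl)
        (sweep B (f z b) v (w z b ∷ u)))
      where
      arith : ∀ τ n → 1 + (τ + 1 + (n + 1)) ≡ τ + 2 + n + 1
      arith = solve-∀

    each⇒ : Body → ∀ z v → each j body ∶
      (mem z , T z (load v)) ⇒ (mem (foldl f z v) , T (foldl f z v) (load (scan f w z v)))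
      [ eachTime (length v) τ ]
    each⇒ B z v = relax (≡⇒≈ˢ (cong (λ t → mem z , T z t) (sym (at-load v))))
        (≡⇒≈ˢ (cong (λ t → mem z′ , T z′ t) restored))
        (≤-reflexive time) (sweep B z v [] ⨟ rewind⇒ (F z′) (v′ ʳ++ []) [])
      where
      z′ = foldl f z v
      v′ = scan f w z v
      restored : at [] (map just (v′ ʳ++ []) ʳ++ []) ≡ load v′
      restored = begin
        at [] (map just (v′ ʳ++ []) ʳ++ []) ≡⟨ cong (λ l → at [] (l ʳ++ [])) (List.map-ʳ++ just v′) ⟩
        at [] ((map just v′ ʳ++ []) ʳ++ []) ≡⟨ cong (at []) (List.ʳ++-ʳ++ (map just v′)) ⟩
        at [] (map just v′ ++ [])           ≡⟨ cong (at []) (List.++-identityʳ (map just v′)) ⟩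
        at [] (map just v′)                 ≡⟨ at-load v′ ⟩
        load v′                             ∎
        where open ≡-Reasoning
      arith : ∀ n τ → n * (τ + 2) + 1 + (n * 2 + 3) ≡ n * (τ + 4) + 4
      arith = solve-∀
      time : length v * (τ + 2) + 1 + (length (v′ ʳ++ []) * 2 + 3) ≡ eachTime (length v) τ
      time rewrite List.length-ʳ++ v′ {[]} | +-identityʳ (length v′) | length-scan f w z v =
        arith (length v) τ

  -- Here tape j only counts: the body is specified for every content t and restores it, so the
  -- effect is plain iteration.
  loop⇒ : ∀ {Z : Set} {j mem} {T : Z → Tape → Vec Tape k} (F : ∀ z → Focus j (T z))
          (f : Z → Z) {body τ} →
          (∀ z t → body ∶ (mem z , T z t) ⇒ (mem (f z) , T (f z) t) [ τ ]) →
          ∀ z v → each j body ∶ (mem z , T z (load v)) ⇒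
            (mem (iterate (length v) f z) , T (iterate (length v) f z) (load v))
            [ eachTime (length v) τ ]
  loop⇒ {mem = mem} {T} F f B z v =
    relax ≈ˢ-refl
      (≡⇒≈ˢ (cong₂ (λ z v → mem z , T z (load v))
        (foldl-iterate f z v) (scan-id (λ z _ → f z) z v)))
      ≤-refl
      (Each.each⇒ {mem = mem} {T} F (λ z _ → f z) (λ _ b → b) (λ z b l r → B z (at l (just b ∷ r))) z v)

iterate-+ : ∀ {Z : Set} a b (f : Z → Z) z → iterate (a + b) f z ≡ iterate b f (iterate a f z)
iterate-+ zero    b f z = refl
iterate-+ (suc a) b f z = iterate-+ a b f (f z)

iterate-* : ∀ {Z : Set} n a (f : Z → Z) z → iterate n (iterate a f) z ≡ iterate (n * a) f z
iterate-* zero    a f z = refl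
iterate-* (suc n) a f z = trans (iterate-* n a f _) (sym (iterate-+ a (n * a) f z))

iterate-cong : ∀ {Z : Set} n {f g : Z → Z} → f ≗ g → iterate n f ≗ iterate n g
iterate-cong zero    e z = refl
iterate-cong (suc n) {f} {g} e z = trans (iterate-cong n e (f z)) (cong (iterate n g) (e z))

-- Logarithms by halving

-- ⌈log₂ c⌉ is the number of halvings c ↦ ⌈c/2⌉ that change c.  Unary halving
-- erases every second mark; the memory holds the parity of the marks passed
-- and whether a mark has been erased.
halve : Bool × Bool → Bool → Bool × Bool
halve (p , e) false = p , e
halve (p , e) true  = not p , e ∨ p

survives : Bool × Bool → Bool → Bool
survives (p , _) b = b ∧ not p

marks : Word → ℕ
marks []          = 0
marks (false ∷ v) = marks v
marks (true ∷ v)  = suc (marks v)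

marks-unary : ∀ n → marks (List.replicate n true) ≡ n
marks-unary zero    = refl
marks-unary (suc n) = cong suc (marks-unary n)

-- The parity decides the rounding: with p false the next mark survives, with p true it is erased.
marks-halve : ∀ p e v → marks (scan halve survives (p , e) v) ≡
              (if p then ⌊ marks v /2⌋ else ⌈ marks v /2⌉)
marks-halve false e []          = refl
marks-halve true  e []          = refl
marks-halve p     e (false ∷ v) = marks-halve p e v
marks-halve false e (true ∷ v)  = cong suc (marks-halve true (e ∨ false) v)
marks-halve true  e (true ∷ v)  = marks-halve false (e ∨ true) v

-- From parity false the second mark is the first to go, so an erasure takes two marks; from parity
-- true one is enough.
erased : ∀ p e v → proj₂ (foldl halve (p , e) v) ≡
         e ∨ (if p then 1 ≤ᵇ marks v else 2 ≤ᵇ marks v)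
erased false e []          = sym (Bool.∨-identityʳ e)
erased true  e []          = sym (Bool.∨-identityʳ e)
erased p     e (false ∷ v) = erased p e v
erased false e (true ∷ v)  = trans (erased true (e ∨ false) v) (cong (_∨ (1 ≤ᵇ marks v)) (Bool.∨-identityʳ e))
erased true  e (true ∷ v)  = trans (erased false (e ∨ true) v)
  (trans (cong (_∨ (2 ≤ᵇ marks v)) (Bool.∨-zeroʳ e)) (sym (Bool.∨-zeroʳ e)))

-- Rounds that start from 0 or 1 change nothing and count nothing, so surplus rounds are harmless:
-- the verifier can run n of them without knowing the logarithm.
halvings : ℕ → ℕ → ℕ
halvings zero    c = 0
halvings (suc j) c = (if 2 ≤ᵇ c then 1 else 0) + halvings j ⌈ c /2⌉

halvings-log : ∀ j c → ⌈log₂ c ⌉ ≤ j → halvings j c ≡ ⌈log₂ c ⌉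
halvings-log zero    c             log≤ = sym (n≤0⇒n≡0 log≤)
halvings-log (suc j) zero          log≤ = halvings-log j 0 z≤n
halvings-log (suc j) (suc zero)    log≤ = halvings-log j 1 z≤n
halvings-log (suc j) (suc (suc c)) log≤ = cong suc (trans (halvings-log j _ half≤) half≡)
  where
  half≡ : ⌈log₂ ⌈ 2 + c /2⌉ ⌉ ≡ ⌈log₂ 2 + c ⌉ ∸ 1
  half≡ = ⌈log₂⌈n/2⌉⌉≡⌈log₂n⌉∸1 (2 + c)
  half≤ : ⌈log₂ ⌈ 2 + c /2⌉ ⌉ ≤ j
  half≤ = subst (_≤ j) (sym half≡) (∸-monoˡ-≤ 1 log≤)

-- Strong induction through n ≤ 2⌈n/2⌉. The density bound uses it to replace n^d by a power of 2,
-- and it depends on rounding the logarithm up.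
n≤2^⌈log₂n⌉ : ∀ n → n ≤ 2 ^ ⌈log₂ n ⌉
n≤2^⌈log₂n⌉ = <-rec _ step
  where
  open ≤-Reasoning
  double : ∀ n → n + n ≡ 2 * n
  double = solve-∀
  step : ∀ n → (∀ {m} → m < n → m ≤ 2 ^ ⌈log₂ m ⌉) → n ≤ 2 ^ ⌈log₂ n ⌉
  step zero          rec = z≤n
  step (suc zero)    rec = s≤s z≤n
  step (suc (suc n)) rec = begin
    2 + n                               ≡⟨ ⌊n/2⌋+⌈n/2⌉≡n (2 + n) ⟨
    ⌊ 2 + n /2⌋ + ⌈ 2 + n /2⌉           ≤⟨ +-monoˡ-≤ _ (⌊n/2⌋≤⌈n/2⌉ (2 + n)) ⟩
    ⌈ 2 + n /2⌉ + ⌈ 2 + n /2⌉           ≡⟨ double ⌈ 2 + n /2⌉ ⟩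
    2 * ⌈ 2 + n /2⌉                     ≤⟨ *-monoʳ-≤ 2 (rec (⌈n/2⌉<n n)) ⟩
    -- From 2 on the logarithm computes to a successor, so the `∸ 1` cancels against the factor 2 by
    -- computation.
    2 * 2 ^ ⌈log₂ ⌈ 2 + n /2⌉ ⌉         ≡⟨ cong (λ k → 2 * 2 ^ k) (⌈log₂⌈n/2⌉⌉≡⌈log₂n⌉∸1 (2 + n)) ⟩
    2 ^ ⌈log₂ 2 + n ⌉                   ∎

n<2^n : ∀ n → n < 2 ^ n
n<2^n zero    = s≤s z≤n
n<2^n (suc n) = subst (suc (suc n) ≤_) (cong (2 ^ n +_) (sym (+-identityʳ (2 ^ n))))
  (+-mono-≤ (m^n>0 2 n) (n<2^n n))

-- Ensures that n rounds of halving are enough.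
⌈log₂n⌉≤n : ∀ n → ⌈log₂ n ⌉ ≤ n
⌈log₂n⌉≤n n = subst (⌈log₂ n ⌉ ≤_) (⌈log₂2^n⌉≡n n) (⌈log₂⌉-mono-≤ (<⇒≤ (n<2^n n)))

-- Polynomial bounds

infixl 6 _⊕_
_⊕_ : Poly → Poly → Poly
[]      ⊕ q       = q
(a ∷ p) ⊕ []      = a ∷ p
(a ∷ p) ⊕ (b ∷ q) = (a + b) ∷ (p ⊕ q)

⊕-eval : ∀ p q n → ⟦ p ⊕ q ⟧ n ≡ ⟦ p ⟧ n + ⟦ q ⟧ n
⊕-eval []      q       n = refl
⊕-eval (a ∷ p) []      n = sym (+-identityʳ _)
⊕-eval (a ∷ p) (b ∷ q) n rewrite ⊕-eval p q n = arith a b n (⟦ p ⟧ n) (⟦ q ⟧ n)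
  where
  arith : ∀ a b n x y → a + b + n * (x + y) ≡ a + n * x + (b + n * y)
  arith = solve-∀

scale : ℕ → Poly → Poly
scale a []      = []
scale a (b ∷ q) = a * b ∷ scale a q

scale-eval : ∀ a q n → ⟦ scale a q ⟧ n ≡ a * ⟦ q ⟧ n
scale-eval a []      n = sym (*-zeroʳ a)
scale-eval a (b ∷ q) n rewrite scale-eval a q n = arith a b n (⟦ q ⟧ n)
  where
  arith : ∀ a b n x → a * b + n * (a * x) ≡ a * (b + n * x)
  arith = solve-∀

infixl 7 _⊗_
_⊗_ : Poly → Poly → Poly
[]      ⊗ q = []
(a ∷ p) ⊗ q = scale a q ⊕ (0 ∷ p ⊗ q)

⊗-eval : ∀ p q n → ⟦ p ⊗ q ⟧ n ≡ ⟦ p ⟧ n * ⟦ q ⟧ n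
⊗-eval []      q n = refl
⊗-eval (a ∷ p) q n rewrite ⊕-eval (scale a q) (0 ∷ p ⊗ q) n | scale-eval a q n | ⊗-eval p q n =
  arith a n (⟦ p ⟧ n) (⟦ q ⟧ n)
  where
  arith : ∀ a n x y → a * y + n * (x * y) ≡ (a + n * x) * y
  arith = solve-∀

IsPoly : (ℕ → ℕ) → Set
IsPoly f = ∃[ p ] ∀ n → f n ≡ ⟦ p ⟧ n

poly-const : ∀ a → IsPoly (λ _ → a)
poly-const a = a ∷ [] , λ n → sym (trans (cong (a +_) (*-zeroʳ n)) (+-identityʳ a))

poly-id : IsPoly (λ n → n)
poly-id = 0 ∷ 1 ∷ [] , λ n → arith n
  where
  arith : ∀ n → n ≡ n * (1 + n * 0)
  arith = solve-∀

poly-+ : ∀ {f g} → IsPoly f → IsPoly g → IsPoly (λ n → f n + g n)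
poly-+ (p , e) (q , e′) = p ⊕ q , λ n → trans (cong₂ _+_ (e n) (e′ n)) (sym (⊕-eval p q n))

poly-* : ∀ {f g} → IsPoly f → IsPoly g → IsPoly (λ n → f n * g n)
poly-* (p , e) (q , e′) = p ⊗ q , λ n → trans (cong₂ _*_ (e n) (e′ n)) (sym (⊗-eval p q n))

poly-eachTime : ∀ {τ} → IsPoly τ → IsPoly (λ n → eachTime n (τ n))
poly-eachTime h = poly-+ (poly-* poly-id (poly-+ h (poly-const 4))) (poly-const 4)

eachTime-mono : ∀ {n n′ τ τ′} → n ≤ n′ → τ ≤ τ′ → eachTime n τ ≤ eachTime n′ τ′
eachTime-mono n≤ τ≤ = +-monoˡ-≤ 4 (*-mono-≤ n≤ (+-monoˡ-≤ 4 τ≤))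

-- The verifier

take-map-++ : ∀ {A B : Set} {m n} (f : A → B) (us : Vec A m) (vs : Vec A n) →
              Vec.take m (Vec.map f (us Vec.++ vs)) ≡ Vec.map f us
take-map-++ f []       vs = refl
take-map-++ f (u ∷ us) vs = cong (f u ∷_) (take-map-++ f us vs)

drop-map-++ : ∀ {A B : Set} {m n} (f : A → B) (us : Vec A m) (vs : Vec A n) →
              Vec.drop m (Vec.map f (us Vec.++ vs)) ≡ Vec.map f vs
drop-map-++ f []       vs = refl
drop-map-++ f (u ∷ us) vs = drop-map-++ f us vs

replicate-+ : ∀ {A : Set} m n (a : A) → replicate (m + n) a ≡ replicate m a Vec.++ replicate n a
replicate-+ zero    n a = refl
replicate-+ (suc m) n a = cong (a ∷_) (replicate-+ m n a)

fromPos : ∀ a {b} → (Symbol → Symbol × Move) → Vec Symbol (a + b) → Vec (Symbol × Move) (a + b)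
fromPos zero    op ss       = Vec.map op ss
fromPos (suc a) op (s ∷ ss) = keep s ∷ fromPos a op ss

fromPos-writes : ∀ {a b} op (us : Vec Tape a) (vs : Vec Tape b) →
  zipWith write (fromPos a op (Vec.map here (us Vec.++ vs))) (us Vec.++ vs) ≡
  us Vec.++ Vec.map (λ t → write (op (here t)) t) vs
fromPos-writes op []       []       = refl
fromPos-writes op []       (v ∷ vs) = cong (_ ∷_) (fromPos-writes op [] vs)
fromPos-writes op (u ∷ us) vs       = cong (u ∷_) (fromPos-writes op us vs)

∧-⇔ : ∀ {a b} {P Q : Set} → (a ≡ true ⇔ P) → (b ≡ true ⇔ Q) → (a ∧ b ≡ true ⇔ (P × Q))
∧-⇔ {true}  p q = mk⇔ (λ e → Equivalence.to p refl , Equivalence.to q e)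
                      (λ (_ , y) → Equivalence.from q y)
∧-⇔ {false} p q = mk⇔ (λ ()) (λ (x , _) → Equivalence.from p x)

is-just-⇔ : ∀ {A : Set} (s : Maybe A) → is-just s ≡ true ⇔ Is-just s
is-just-⇔ (just _) = mk⇔ (λ _ → just tt) (λ _ → refl)
is-just-⇔ nothing  = mk⇔ (λ ()) (λ ())

here-iterate-right : ∀ i l r → here (iterate i (go right) (at l r)) ≡ cell r i
here-iterate-right zero    l r = cell-pop₁ r
here-iterate-right (suc i) l r =
  trans (here-iterate-right i (proj₁ (pop r) ∷ l) (proj₂ (pop r))) (cell-pop₂ r i)

unary : ℕ → Word
unary n = List.replicate n true

cell-unary : ∀ n i → is-just (cell (map just (unary n)) i) ≡ true ⇔ i < n
cell-unary zero    i       = mk⇔ (λ ()) (λ ())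
cell-unary (suc n) zero    = mk⇔ (λ _ → s≤s z≤n) (λ _ → refl)
cell-unary (suc n) (suc i) = mk⇔ (s≤s ∘ Equivalence.to (cell-unary n i))
                                 (Equivalence.from (cell-unary n i) ∘ ≤-pred)

agree : Symbol → Symbol → Bool
agree (just a) (just b) = does (a Bool.≟ b)
agree _        _        = false

module Verifier (d : ℕ) (V : Machine 1) (L : Language) (t : Poly) where

  private module V = Machine V

  w m k : ℕ
  w = V.work
  m = 3 + length t
  k = 2 + (w + m)

  -- The tapes: the first input x; the tapes of V, beginning with the second
  -- input; then the budget, the counter of the halvings, the marks that are
  -- halved, and one tape for each coefficient of t.
  layout : Tape → Vec Tape (1 + w) → Vec Tape m → Vec Tape k
  layout X vt ot = X ∷ (vt Vec.++ ot)

  jx jy : Fin k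
  jx = zero
  jy = suc zero

  jv : Fin (1 + w) → Fin k
  jv o = suc (o ↑ˡ m)

  jo : Fin m → Fin k
  jo i = suc (suc w ↑ʳ i)

  focus-x : ∀ vt ot → Focus jx (λ X → layout X vt ot)
  focus-x vt ot = record { look = λ _ → refl ; put = λ _ _ → refl }

  focus-y : ∀ X vt ot → Focus jy (λ Y → layout X (Y ∷ vt) ot)
  focus-y X vt ot = record { look = λ _ → refl ; put = λ _ _ → refl }

  focus-v : ∀ o X vt ot → Focus (jv o) (λ t → layout X (vt [ o ]≔ t) ot)
  focus-v o X vt ot = record
    { look = λ t → trans (Vec.lookup-++ˡ (vt [ o ]≔ t) ot o) (Vec.lookup∘update o vt t)
    ; put  = λ t t′ → cong (X ∷_) (trans (Vec.[]≔-++-↑ˡ (vt [ o ]≔ t) ot o)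
                        (cong (Vec._++ ot) (Vec.[]≔-idempotent vt o)))
    }

  focus-o : ∀ i X vt ot → Focus (jo i) (λ t → layout X vt (ot [ i ]≔ t))
  focus-o i X vt ot = record
    { look = λ t → trans (Vec.lookup-++ʳ vt (ot [ i ]≔ t) i) (Vec.lookup∘update i ot t)
    ; put  = λ t t′ → cong (X ∷_) (trans (Vec.[]≔-++-↑ʳ vt (ot [ i ]≔ t) i)
                        (cong (vt Vec.++_) (Vec.[]≔-idempotent ot i)))
    }

  -- The simulated state of V and the two flags of `halve`; at the end `judge` stores the verdict in
  -- the second flag.
  G : Set
  G = V.State × Bool × Bool

  open Loops {G} {k} (co L) (jv V.queryTape)

  others : (Symbol → Symbol × Move) → Cmd G k
  others op = prim λ g → move λ ss → g , fromPos (2 + w) op ss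

  others⇒ : ∀ op {g X vt t t′} → write (op (here t)) t ≈ t′ → others op ∶
    (g , layout X vt (replicate m t)) ⇒ (g , layout X vt (replicate m t′)) [ 1 ]
  others⇒ op {X = X} {vt} {t} {t′} e =
    relax ≈ˢ-refl (refl , subst (_≈* layout X vt (replicate m t′)) (sym written)
      (≈-refl ∷ Pointwise.++⁺ ≈*-refl (all-≈ m))) ≤-refl prim
    where
    written = trans (fromPos-writes op (X ∷ vt) (replicate m t))
      (cong (layout X vt) (Vec.map-replicate (λ t → write (op (here t)) t) t m))
    all-≈ : ∀ m → replicate m (write (op (here t)) t) ≈* replicate m t′
    all-≈ zero    = []
    all-≈ (suc m) = e ∷ all-≈ m

  -- With x as the counter, one pass writes a mark on all own tapes at once and a second pass brings
  -- their heads back.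
  fill : Cmd G k
  fill = each jx (others λ _ → just true , right) ⨟ each jx (others λ s → s , left)

  fillTime : ℕ → ℕ
  fillTime n = eachTime n 1 + eachTime n 1

  zip-left : List Symbol × List Symbol → List Symbol × List Symbol
  zip-left ([]    , r) = [] , nothing ∷ r
  zip-left (s ∷ l , r) = l , s ∷ r

  go-zip-left : ∀ z → go left (at (proj₁ z) (proj₂ z)) ≈
                      at (proj₁ (zip-left z)) (proj₂ (zip-left z))
  go-zip-left ([]    , r) = go-left-edge r
  go-zip-left (s ∷ l , r) = go-left s l r

  iterate-zip-left : ∀ n i s →
    iterate n zip-left (List.replicate n s , List.replicate i s) ≡ ([] , List.replicate (n + i) s)
  iterate-zip-left zero    i s = refl
  iterate-zip-left (suc n) i s =
    trans (iterate-zip-left n (suc i) s) (cong (λ j → [] , List.replicate j s) (+-suc n i))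

  iterate-suc : ∀ n i → iterate n suc i ≡ n + i
  iterate-suc zero    i = refl
  iterate-suc (suc n) i = trans (iterate-suc n (suc i)) (+-suc n i)

  fill⇒ : ∀ {g vt} x → fill ∶
    (g , layout (load x) vt (replicate m blankTape)) ⇒
    (g , layout (load x) vt (replicate m (load (unary (length x))))) [ fillTime (length x) ]
  fill⇒ {g} {vt} x =
    relax ≈ˢ-refl (≡⇒≈ˢ (cong (λ t → g , layout (load x) vt (replicate m t)) filled)) ≤-refl
      (loop⇒ {mem = λ _ → g} {λ i t → layout t vt (replicate m (written i))} (λ i → focus-x vt _) suc
         (λ i t → others⇒ (λ _ → just true , right) ≈-refl) 0 x ⨟
       relax (≡⇒≈ˢ (cong (λ i → g , layout (load x) vt (replicate m (written i))) count)) ≈ˢ-refl ≤-refl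
         (loop⇒ {mem = λ _ → g} {λ z t → layout t vt (replicate m (at (proj₁ z) (proj₂ z)))}
           (λ z → focus-x vt _) zip-left (λ z t → others⇒ (λ s → s , left) (go-zip-left z))
           (List.replicate n (just true) , []) x))
    where
    n = length x
    written : ℕ → Tape
    written i = at (List.replicate i (just true)) []
    count : iterate n suc 0 ≡ n
    count = trans (iterate-suc n 0) (+-identityʳ n)
    end : List Symbol × List Symbol
    end = iterate n zip-left (List.replicate n (just true) , [])
    filled : at (proj₁ end) (proj₂ end) ≡ load (unary n)
    filled = begin
      at (proj₁ end) (proj₂ end)
        ≡⟨ cong (λ z → at (proj₁ z) (proj₂ z)) (iterate-zip-left n 0 (just true)) ⟩
      at [] (List.replicate (n + 0) (just true))
        ≡⟨ cong (λ i → at [] (List.replicate i (just true))) (+-identityʳ n) ⟩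
      at [] (List.replicate n (just true))     ≡⟨ cong (at []) (List.map-replicate just n true) ⟨
      at [] (map just (unary n))               ≡⟨ at-load (unary n) ⟩
      load (unary n)                           ∎
      where open ≡-Reasoning

  jb jh jm : Fin m
  jb = zero
  jh = suc zero
  jm = suc (suc zero)

  -- The budget tape holds 1ⁿ with n = |x|.  Its head moves right by one cell for
  -- each unit spent, so that it reads a blank once n units are spent.
  spendLength : Cmd G k
  spendLength = each jy (shift (jo jb) right)

  spendLength⇒ : ∀ {g X vw B ot} y → spendLength ∶
    (g , layout X (load y ∷ vw) (B ∷ ot)) ⇒
    (g , layout X (load y ∷ vw) (iterate (length y) (go right) B ∷ ot)) [ eachTime (length y) 1 ]
  spendLength⇒ {g} {X} {vw} {B} {ot} y =
    loop⇒ {mem = λ _ → g} {λ B Y → layout X (Y ∷ vw) (B ∷ ot)} (λ B → focus-y X vw (B ∷ ot)) (go right)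
      (λ B Y → shift⇒ (focus-o jb X (Y ∷ vw) (B ∷ ot)) right ≈-refl) B y

  -- An erased mark becomes the letter `false`, not a blank, so the next sweep still reaches every
  -- cell.
  onMark : G → Symbol → G × Symbol × Move
  onMark (q , pe) (just b) = (q , halve pe b) , just (survives pe b) , stay
  onMark g        nothing  = g , nothing , stay

  ifErased : Bool → Move
  ifErased e = if e then right else stay

  advance : G → Symbol → G × Symbol × Move
  advance g@(_ , _ , e) s = g , s , ifErased e

  -- The flags are reset so that the erasure flag reports on this round alone; if it is set, the
  -- round has changed the number of marks and d units are paid.
  pass : Cmd G k
  pass = update (λ (q , _) _ → q , false , false) ⨟ each (jo jm) (local (jo jm) onMark) ⨟
         repeat d (local (jo jb) advance)

  passTime : ℕ → ℕ
  passTime n = 1 + (eachTime n 1 + (d * 1 + 1))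

  -- The invariant `size` gives all rounds the same time bound.
  record Halving (n : ℕ) : Set where
    constructor halving
    field
      flags   : Bool × Bool
      budget  : Tape
      marking : Word
      size    : length marking ≡ n

  open Halving

  afterPass : ∀ {n} → Halving n → Halving n
  afterPass (halving _ B v e) = halving
    (foldl halve (false , false) v)
    (iterate d (go (ifErased (proj₂ (foldl halve (false , false) v)))) B)
    (scan halve survives (false , false) v)
    (trans (length-scan halve survives (false , false) v) e)

  budget-passes : ∀ {n} j (z : Halving n) → budget (iterate j afterPass z) ≡
    iterate (halvings j (marks (marking z)) * d) (go right) (budget z)
  budget-passes zero    z                     = refl
  budget-passes (suc j) z@(halving _ B v e)
    rewrite budget-passes j (afterPass z)
          | erased false false v
          | marks-halve false false v
    with 2 ≤ᵇ marks v
  ... | true  = sym (iterate-+ d (halvings j ⌈ marks v /2⌉ * d) (go right) B)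
  ... | false = cong (iterate (halvings j ⌈ marks v /2⌉ * d) (go right)) (stays d)
    where
    stays : ∀ d → iterate d (go stay) B ≡ B
    stays zero    = refl
    stays (suc d) = stays d

  module _ (q : V.State) (X : Tape) (vt : Vec Tape (1 + w)) (cs : Vec Tape (length t)) where

    halvingTapes : ∀ {n} → Halving n → Tape → Vec Tape k
    halvingTapes z H = layout X vt (budget z ∷ H ∷ load (marking z) ∷ cs)

    pass⇒ : ∀ {n} (z : Halving n) H → pass ∶
      ((q , flags z) , halvingTapes z H) ⇒
      ((q , flags (afterPass z)) , halvingTapes (afterPass z) H) [ passTime n ]
    pass⇒ z@(halving _ B v e) H =
      update⇒ _ ⨟
      relax ≈ˢ-refl ≈ˢ-refl (≤-reflexive (cong (λ i → eachTime i 1) e))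
        (Each.each⇒ {mem = λ pe → q , pe} {λ _ u → layout X vt (B ∷ H ∷ u ∷ cs)}
          -- The second `H` is a placeholder: `focus-o` overwrites the entry at `jm`.
          (λ _ → focus-o jm X vt (B ∷ H ∷ H ∷ cs)) halve survives
          (λ pe b l r → local⇒ (focus-o jm X vt (B ∷ H ∷ H ∷ cs)) onMark ≈-refl)
          (false , false) v) ⨟
      repeat⇒ (λ B → (q , pe′) , layout X vt (B ∷ H ∷ K ∷ cs)) (go (ifErased (proj₂ pe′)))
        (λ B → local⇒ (focus-o jb X vt (B ∷ H ∷ K ∷ cs)) advance ≈-refl) d B
      where
      pe′ = flags (afterPass z)
      K   = load (marking (afterPass z))

  spendLog : Cmd G k
  spendLog = each (jo jh) pass

  spendLog⇒ : ∀ {q pe X vt B cs} n → ∃[ pe′ ] ∃[ v ] (spendLog ∶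
    ((q , pe) , layout X vt (B ∷ load (unary n) ∷ load (unary n) ∷ cs)) ⇒
    ((q , pe′) , layout X vt (iterate (⌈log₂ n ⌉ * d) (go right) B ∷ load (unary n) ∷ load v ∷ cs))
    [ eachTime n (passTime n) ])
  spendLog⇒ {q} {pe} {X} {vt} {B} {cs} n =
    flags end , marking end ,
    relax ≈ˢ-refl
      (≡⇒≈ˢ (cong (λ B → (q , flags end) , layout X vt (B ∷ load (unary n) ∷ load (marking end) ∷ cs)) spent))
      (≤-reflexive (cong (λ i → eachTime i (passTime n)) (List.length-replicate n)))
      (loop⇒ {mem = λ z → q , flags z} {halvingTapes q X vt cs}
        (λ z → focus-o jh X vt (budget z ∷ B ∷ load (marking z) ∷ cs)) afterPass
        (pass⇒ q X vt cs) z₀ (unary n))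
    where
    z₀ end : Halving n
    z₀  = halving pe B (unary n) (List.length-replicate n)
    end = iterate (length (unary n)) afterPass z₀
    spent : budget end ≡ iterate (⌈log₂ n ⌉ * d) (go right) B
    spent = trans (budget-passes (length (unary n)) z₀)
      (cong (λ j → iterate (j * d) (go right) B)
        (trans (cong₂ halvings (List.length-replicate n) (marks-unary n))
               (halvings-log n n (⌈log₂n⌉≤n n))))

  -- Since the oracle is the complement of L, the answers are interchanged.
  simStep : V.State → Bool × Bool → Instruction V.State (1 + w) → Step G k
  -- A halted V idles, exactly as `exec` does, so the clock may tick on past its halting.
  simStep q pe (halt _)      = move λ ss → (q , pe) , Vec.map keep ss
  simStep q pe (query q₁ q₀) = ask (q₀ , pe) (q₁ , pe)
  simStep q pe (act δ)       = move λ where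
    (s ∷ ss) → let r = δ (Vec.take (suc w) ss) in
      (proj₁ r , pe) , keep s ∷ (proj₂ r Vec.++ Vec.map keep (Vec.drop (suc w) ss))

  tick : Cmd G k
  tick = prim λ (q , pe) → simStep q pe (V.program q)

  tick⇒ : ∀ {pe X ot} c → tick ∶
    ((V.state c , pe) , layout X (V.tapes c) ot) ⇒
    ((V.state (V.step L c) , pe) , layout X (V.tapes (V.step L c)) ot) [ 1 ]
  tick⇒ {pe} {X} {ot} c@(V.config q vt) =
    relax ≈ˢ-refl (≡⇒≈ˢ (performs (V.program q))) ≤-refl prim
    where
    performs : ∀ i → perform (simStep q pe i) (layout X vt ot) ≡
      ((V.state (V.exec L i c) , pe) , layout X (V.tapes (V.exec L i c)) ot)
    performs (halt _) = cong ((q , pe) ,_) (keep-all (layout X vt ot))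
    performs (query q₁ q₀)
      rewrite Vec.lookup-++ˡ vt ot V.queryTape with L (contents (lookup vt V.queryTape))
    ... | true  = refl
    ... | false = refl
    performs (act δ)
      rewrite take-map-++ here vt ot | drop-map-++ here vt ot
            | Vec.zipWith-++ write (proj₂ (δ (Vec.map here vt))) (Vec.map keep (Vec.map here ot)) vt ot
            | keep-all ot = refl

  -- By Horner's rule, loops nested to the depth of the degree make ⟦ p ⟧ n ticks.
  clock : (p : Poly) → (Fin (length p) → Fin m) → Cmd G k
  clock []      ι = skip
  clock (a ∷ p) ι = repeat a tick ⨟ each (jo (ι zero)) (clock p (ι ∘ suc))

  clockTime : Poly → ℕ → ℕ
  clockTime []      n = 1
  clockTime (a ∷ p) n = a * 1 + 1 + eachTime n (clockTime p n)

  run-iterate : ∀ s c → V.run L s c ≡ iterate s (V.step L) c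
  run-iterate zero    c = refl
  run-iterate (suc s) c = run-iterate s (V.step L c)

  -- Injectivity of `ι` keeps the tape of an outer loop apart from those of the inner loops, which
  -- therefore still hold 1ⁿ while the outer head is in the middle of its tape.
  clock⇒ : ∀ {pe X} n p ι → (∀ {i j} → ι i ≡ ι j → i ≡ j) →
    ∀ ot → (∀ i → lookup ot (ι i) ≡ load (unary n)) → ∀ c → clock p ι ∶
    ((V.state c , pe) , layout X (V.tapes c) ot) ⇒
    ((V.state (V.run L (⟦ p ⟧ n) c) , pe) , layout X (V.tapes (V.run L (⟦ p ⟧ n) c)) ot)
    [ clockTime p n ]
  clock⇒ n []      ι inj ot full c = skip⇒
  clock⇒ {pe} {X} n (a ∷ p) ι inj ot full c =
    relax ≈ˢ-refl (≡⇒≈ˢ (cong₂ (λ c ot → (V.state c , pe) , layout X (V.tapes c) ot) total unchanged))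
      (+-monoʳ-≤ (a * 1 + 1)
        (≤-reflexive (cong (λ i → eachTime i (clockTime p n)) (List.length-replicate n))))
      (repeat⇒ (λ c → (V.state c , pe) , layout X (V.tapes c) ot) (V.step L) tick⇒ a c ⨟
       relax (≡⇒≈ˢ (cong (λ ot → (V.state c₁ , pe) , layout X (V.tapes c₁) ot) (sym unchanged)))
         ≈ˢ-refl ≤-refl
       (loop⇒ {mem = λ c → V.state c , pe} {λ c t → layout X (V.tapes c) (ot [ ι zero ]≔ t)}
         (λ c → focus-o (ι zero) X (V.tapes c) ot) (V.run L (⟦ p ⟧ n))
         (λ c t → clock⇒ n p (ι ∘ suc) (Fin.suc-injective ∘ inj) (ot [ ι zero ]≔ t)
            (λ i → trans (Vec.lookup∘update′ (Fin.0≢1+n ∘ sym ∘ inj) ot t) (full (suc i))) c)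
         c₁ (unary n)))
    where
    c₁ = iterate a (V.step L) c
    unchanged : ot [ ι zero ]≔ load (unary n) ≡ ot
    unchanged = trans (cong (ot [ ι zero ]≔_) (sym (full zero))) (Vec.[]≔-lookup ot (ι zero))
    open ≡-Reasoning
    total : iterate (length (unary n)) (V.run L (⟦ p ⟧ n)) c₁ ≡ V.run L (a + n * ⟦ p ⟧ n) c
    total = begin
      iterate (length (unary n)) (V.run L (⟦ p ⟧ n)) c₁
        ≡⟨ cong (λ i → iterate i (V.run L (⟦ p ⟧ n)) c₁) (List.length-replicate n) ⟩
      iterate n (V.run L (⟦ p ⟧ n)) c₁            ≡⟨ iterate-cong n (run-iterate (⟦ p ⟧ n)) c₁ ⟩
      iterate n (iterate (⟦ p ⟧ n) (V.step L)) c₁ ≡⟨ iterate-* n (⟦ p ⟧ n) (V.step L) c₁ ⟩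
      iterate (n * ⟦ p ⟧ n) (V.step L) c₁         ≡⟨ iterate-+ a (n * ⟦ p ⟧ n) (V.step L) c ⟨
      iterate (a + n * ⟦ p ⟧ n) (V.step L) c      ≡⟨ run-iterate (a + n * ⟦ p ⟧ n) c ⟨
      V.run L (a + n * ⟦ p ⟧ n) c                 ∎

  match : Cmd G k
  match = while (λ ss → agree (lookup ss jx) (lookup ss (jv V.outTape)))
                  (shift jx right ⨟ shift (jv V.outTape) right)

  module _ (g : G) (vt : Vec Tape (1 + w)) (ot : Vec Tape m) where

    pair : Tape → Tape → Vec Tape k
    pair X O = layout X (vt [ V.outTape ]≔ O) ot

    agree-heads : ∀ a u r l l′ →
      let ss = Vec.map here (pair (at l (just a ∷ map just u)) (at l′ r)) in
      agree (lookup ss jx) (lookup ss (jv V.outTape)) ≡ agree (just a) (proj₁ (pop r))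
    agree-heads a u r l l′ =
      cong (agree (just a)) (focus-here (focus-v V.outTape (at l (just a ∷ map just u)) vt ot) (at l′ r))

    -- The heads stop at the first cell where they disagree or one is blank; both are blank exactly
    -- when the two words end together.
    match⇒ : ∀ u r l l′ → ∃[ X ] ∃[ O ]
      (match ∶ (g , pair (at l (map just u)) (at l′ r)) ⇒ (g , pair X O)
        [ length u * 2 + length u + 1 ])
      × (is-nothing (here X) ∧ is-nothing (here O) ≡ true ⇔ bits r ≡ u)
    match⇒ [] r l l′ = _ , _ , stop refl , blank r
      where
      blank : ∀ r → is-nothing (proj₁ (pop r)) ≡ true ⇔ bits r ≡ []
      blank []            = mk⇔ (λ _ → refl) (λ _ → refl)
      blank (nothing ∷ _) = mk⇔ (λ _ → refl) (λ _ → refl)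
      blank (just _ ∷ _)  = mk⇔ (λ ()) (λ ())
    match⇒ (a ∷ u) [] l l′ = _ , _ ,
      relax ≈ˢ-refl ≈ˢ-refl (s≤s z≤n) (stop (agree-heads a u [] l l′)) , mk⇔ (λ ()) (λ ())
    match⇒ (a ∷ u) (nothing ∷ r) l l′ = _ , _ ,
      relax ≈ˢ-refl ≈ˢ-refl (s≤s z≤n) (stop (agree-heads a u (nothing ∷ r) l l′)) , mk⇔ (λ ()) (λ ())
    match⇒ (a ∷ u) (just b ∷ r) l l′ with a Bool.≟ b in eq
    ... | no a≢b = _ , _ ,
      relax ≈ˢ-refl ≈ˢ-refl (s≤s z≤n) (stop (trans (agree-heads a u (just b ∷ r) l l′) (cong does eq))) ,
      mk⇔ (λ ()) (λ e → contradiction (sym (List.∷-injectiveˡ e)) a≢b)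
    ... | yes refl =
      let X , O , run , iff = match⇒ u r (just a ∷ l) (just a ∷ l′) in
      X , O ,
      relax ≈ˢ-refl ≈ˢ-refl (≤-reflexive (arith (length u)))
        (again (trans (agree-heads a u (just b ∷ r) l l′) (cong does eq))
          (shift⇒ (focus-x _ ot) right ≈-refl ⨟ shift⇒ (focus-v V.outTape _ vt ot) right ≈-refl) run) ,
      mk⇔ (cong (a ∷_) ∘ Equivalence.to iff) (Equivalence.from iff ∘ List.∷-injectiveʳ)
      where
      arith : ∀ n → 1 + (2 + (n * 2 + n + 1)) ≡ suc n * 2 + suc n + 1
      arith = solve-∀

  -- The last conjunct is the strict inequality: by `cell-unary`, the budget head still reads a mark
  -- iff fewer than n units were spent.
  judge : Cmd G k
  judge = update λ (q , _) ss → q , false ,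
    is-just (V.verdict (V.program q)) ∧
    ((is-nothing (lookup ss jx) ∧ is-nothing (lookup ss (jv V.outTape))) ∧
     is-just (lookup ss (jo jb)))

  -- The length of y is spent before the clock starts, because the tape of y is the input tape of V,
  -- which V may overwrite.
  verify : Cmd G k
  verify = fill ⨟ spendLength ⨟ spendLog ⨟ clock t (λ i → suc (suc (suc i))) ⨟ match ⨟ judge

  verifyTime : ℕ → ℕ → ℕ
  verifyTime n l = fillTime n + (eachTime l 1 + (eachTime n (passTime n) +
    (clockTime t n + (n * 2 + n + 1 + 1))))

  open Complexity d V L t

  verify⇒ : ∀ x y → ∃[ q ] ∃[ β ] ∃[ T ] (verify ∶
    ((V.start , false , false) , layout (load x) (V.tapes (V.initial [ y ])) (replicate m blankTape)) ⇒
    ((q , false , β) , T) [ verifyTime (length x) (length y) ])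
    × (β ≡ true ⇔ (Produces y x × length y + ⌈log₂ length x ⌉ * d < length x))
  verify⇒ x y =
    let pe′ , v , log-run           = spendLog⇒ {vt = V.tapes c₀} {B₁} {replicate (length t) U} n
        ot                          = B₂ ∷ U ∷ load v ∷ replicate (length t) U
        full                        = λ i → Vec.lookup-replicate {n = length t} i U
        X , O , match-run , matches = match⇒ (V.state c₁ , pe′) (V.tapes c₁) ot x
                                        (here O₁ ∷ after O₁) [] (before O₁)
        ss                          = Vec.map here (pair (V.state c₁ , pe′) (V.tapes c₁) ot X O)
        here-O                      = focus-here (focus-v V.outTape X (V.tapes c₁) ot) O
        here-B                      = focus-here (focus-o jb X (V.tapes c₁ [ V.outTape ]≔ O) ot) B₂
        outputs                     = subst₂ (λ o b → (is-nothing (here X) ∧ is-nothing o) ∧ is-just b ≡ true ⇔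
                                          (V.output c₁ ≡ x × length y + ⌈log₂ n ⌉ * d < n))
                                        (sym here-O) (sym here-B) (∧-⇔ matches within-budget)
        accepts                     = ∧-⇔ (is-just-⇔ (V.result c₁)) outputs
    in _ , _ , _ ,
       (fill⇒ {vt = V.tapes c₀} x ⨟ spendLength⇒ y ⨟ log-run ⨟
        clock⇒ n t (λ i → suc (suc (suc i))) (λ { refl → refl }) ot full c₀ ⨟
        relax (≡⇒≈ˢ (cong₂ (λ X vt → (V.state c₁ , pe′) , layout X vt ot)
                 (sym (at-load x)) (sym (Vec.[]≔-lookup (V.tapes c₁) V.outTape)))) ≈ˢ-refl ≤-refl match-run ⨟
        update⇒ _) ,
       mk⇔ (λ e → let h , o , b = Equivalence.to accepts e in (h , o) , b)
           (λ ((h , o) , b) → Equivalence.from accepts (h , o , b))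
    where
    n  = length x
    U  = load (unary n)
    c₀ = V.initial [ y ]
    c₁ = V.run L (⟦ t ⟧ n) c₀
    O₁ = lookup (V.tapes c₁) V.outTape
    B₁ = iterate (length y) (go right) U
    B₂ = iterate (⌈log₂ n ⌉ * d) (go right) B₁
    within-budget : is-just (here B₂) ≡ true ⇔ length y + ⌈log₂ n ⌉ * d < n
    within-budget = subst (λ s → is-just s ≡ true ⇔ length y + ⌈log₂ n ⌉ * d < n)
      (sym cell-B₂) (cell-unary n (length y + ⌈log₂ n ⌉ * d))
      where
      cell-B₂ : here B₂ ≡ cell (map just (unary n)) (length y + ⌈log₂ n ⌉ * d)
      cell-B₂ = begin
        here B₂ ≡⟨ cong here (iterate-+ (length y) (⌈log₂ n ⌉ * d) (go right) U) ⟨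
        here (iterate spent (go right) U) ≡⟨ cong (here ∘ iterate spent (go right)) (at-load (unary n)) ⟨
        here (iterate spent (go right) (at [] (map just (unary n))))
          ≡⟨ here-iterate-right spent [] (map just (unary n)) ⟩
        cell (map just (unary n)) spent ∎
        where
        open ≡-Reasoning
        spent = length y + ⌈log₂ n ⌉ * d

-- Patching a machine at finitely many words

polyTime : ∀ {m} (M : Machine m) A {f} → IsPoly f → let open Machine M in
  (∀ xs → ∃[ s ] s ≤ f (Vec.sum (Vec.map length xs)) × ∃[ b ] result (run A s (initial xs)) ≡ just b) →
  PolyTime M A
polyTime M A (p , f≡) halts = p , λ xs →
  let s , s≤ , _ , r≡ = halts xs
  in result⇒halts M A (≤-trans s≤ (≤-reflexive (f≡ (Vec.sum (Vec.map length xs))))) r≡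

contents-load : ∀ x → contents (load x) ≡ x
contents-load []      = refl
contents-load (b ∷ x) = cong (b ∷_) (bits-just x)
  where
  bits-just : ∀ x → bits (map just x) ≡ x
  bits-just []      = refl
  bits-just (b ∷ x) = cong (b ∷_) (bits-just x)

asker : Machine 1
asker = record
  { State     = ⊤ ⊎ Bool
  ; size      = 3
  ; finite    = proj₂ (⊎-finite ⊤-finite Bool-finite)
  ; work      = 0
  ; queryTape = zero
  ; outTape   = zero
  ; start     = inj₁ tt
  ; program   = λ { (inj₁ tt) → query (inj₂ true) (inj₂ false) ; (inj₂ b) → halt b }
  }

-- Places `Πᵖ i` inside `P^ (Πᵖ i)`, which turns the assumed lower bound into a separation from
-- `Πᵖ i`.
oracle∈P : ∀ A → A ∈ P[ A ]
oracle∈P A = asker , polyTime asker A (poly-const 1) (λ { (x ∷ []) → 1 , ≤-refl , A x , asks x }) ,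
             λ x → 1 , asks x
  where
  open Machine asker
  asks : ∀ x → result (run A 1 (initial [ x ])) ≡ just (A x)
  asks x rewrite contents-load x with A x
  ... | true  = refl
  ... | false = refl

module Patch (M : Machine 1) (A : Language) (w : Word) (b : Bool) where

  private module M = Machine M

  k : ℕ
  k = 1 + M.work

  probeStep : Bool → Bool → Symbol → Bool × Symbol × Move
  probeStep c false s = false , s , stay
  probeStep c true  s = if agree s (just c) then (true , s , right) else (false , s , stay)

  endStep : Bool → Symbol → Bool × Symbol × Move
  endStep ok s = ok ∧ is-nothing s , s , stay

  -- The fixed word w is unrolled into the command. After a mismatch the memory is false and the
  -- remaining steps idle, so the number of steps is always |w| + 1.
  probe : Word → Cmd Bool k
  probe []      = local zero endStep
  probe (c ∷ w) = local zero (probeStep c) ⨟ probe w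

  open Loops {Bool} {k} A M.queryTape

  T : Tape → Vec Tape k
  T t = t ∷ replicate M.work blankTape

  focus : Focus zero T
  focus = record { look = λ _ → refl ; put = λ _ _ → refl }

  failed⇒ : ∀ w t → probe w ∶ (false , T t) ⇒ (false , T t) [ length w + 1 ]
  failed⇒ []      t = local⇒ focus endStep ≈-refl
  failed⇒ (c ∷ w) t = local⇒ focus (probeStep c) ≈-refl ⨟ failed⇒ w t

  -- The last component says that the tape still holds the same word, only with a displaced head;
  -- `rewind` can thus restore the input for M.
  probe⇒ : ∀ w u v → ∃[ ok ] ∃[ u′ ] ∃[ v′ ]
    (probe w ∶ (true , T (at (map just u) (map just v))) ⇒
               (ok , T (at (map just u′) (map just v′))) [ length w + 1 ])
    × (ok ≡ true ⇔ v ≡ w) × u′ List.ʳ++ v′ ≡ u List.ʳ++ v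
  probe⇒ []      u []      =
    _ , u , _ , local⇒ focus endStep ≈-refl , mk⇔ (λ _ → refl) (λ _ → refl) , refl
  probe⇒ []      u (a ∷ v) =
    _ , u , a ∷ v , local⇒ focus endStep ≈-refl , mk⇔ (λ ()) (λ ()) , refl
  probe⇒ (c ∷ w) u []      =
    _ , u , [] , (local⇒ focus (probeStep c) ≈-refl ⨟ failed⇒ w _) , mk⇔ (λ ()) (λ ()) , refl
  probe⇒ (c ∷ w) u (a ∷ v) with a Bool.≟ c in eq
  ... | yes refl =
    let ok , u′ , v′ , r , iff , same = probe⇒ w (a ∷ u) v
    in ok , u′ , v′ , (step⇒ ⨟ r) ,
       mk⇔ (cong (a ∷_) ∘ Equivalence.to iff) (Equivalence.from iff ∘ List.∷-injectiveʳ) , same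
    where
    step⇒ : local zero (probeStep a) ∶ (true , T (at (map just u) (just a ∷ map just v))) ⇒
            (true , T (at (map just (a ∷ u)) (map just v))) [ 1 ]
    step⇒ with r ← local⇒ focus (probeStep a) {true} {at (map just u) (just a ∷ map just v)} ≈-refl
      rewrite eq = r
  ... | no a≢c =
    false , u , a ∷ v , (step⇒ ⨟ failed⇒ w _) ,
    mk⇔ (λ ()) (λ e → contradiction (List.∷-injectiveˡ e) a≢c) , refl
    where
    step⇒ : local zero (probeStep c) ∶ (true , T (at (map just u) (just a ∷ map just v))) ⇒
            (false , T (at (map just u) (just a ∷ map just v))) [ 1 ]
    step⇒ with r ← local⇒ focus (probeStep c) {true} {at (map just u) (just a ∷ map just v)} ≈-refl
      rewrite eq = r

  probeTime : ℕ → ℕ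
  probeTime n = length w + 1 + (n * 2 + 3)

  recognize⇒ : ∀ x → ∃[ ok ] (probe w ⨟ rewind zero ∶ (true , T (load x)) ⇒ (ok , T (load x))
    [ probeTime (length x) ]) × (ok ≡ true ⇔ x ≡ w)
  recognize⇒ x =
    let ok , u , v , r , iff , same = probe⇒ w [] x
    in ok ,
       relax (≡⇒≈ˢ (cong (λ t → true , T t) (sym (at-load x))))
         (≡⇒≈ˢ (cong (λ t → ok , T t) (rewound u v same)))
         (+-monoʳ-≤ (length w + 1) (+-monoˡ-≤ 3 (*-monoˡ-≤ 2 (shorter u v same))))
         (r ⨟ rewind⇒ focus u (map just v)) ,
       iff
    where
    rewound : ∀ u v → u List.ʳ++ v ≡ x → at [] (map just u List.ʳ++ map just v) ≡ load x
    rewound u v e = trans (cong (at []) (trans (sym (List.map-ʳ++ just u)) (cong (map just) e))) (at-load x)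
    shorter : ∀ u v → u List.ʳ++ v ≡ x → length u ≤ length x
    shorter u v e = ≤-trans (m≤m+n (length u) (length v))
      (≤-reflexive (trans (sym (List.length-ʳ++ u)) (cong length e)))

  exit : Bool → Bool ⊎ M.State
  exit true  = inj₁ b
  exit false = inj₂ M.start

  tail : Bool ⊎ M.State → Instruction (Bool ⊎ M.State) k
  tail (inj₁ b) = halt b
  tail (inj₂ q) = mapStates inj₂ (M.program q)

  module P = Assemble {1} {M.work} Bool-finite (⊎-finite Bool-finite (M.size , M.finite))
    M.queryTape M.outTape (probe w ⨟ rewind zero) true exit tail

  patched : Machine 1
  patched = P.machine

  private module P′ = Machine patched

  embed : M.Config → P′.Config
  embed (M.config q T) = P′.config (inj₂ (inj₂ q)) T

  embed-step : ∀ c → P′.step A (embed c) ≡ embed (M.step A c)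
  embed-step (M.config q T) with M.program q
  ... | halt _  = refl
  ... | act δ   = refl
  ... | query q₁ q₀ with A (contents (lookup T M.queryTape))
  ...   | true  = refl
  ...   | false = refl

  embed-run : ∀ s c → P′.run A s (embed c) ≡ embed (M.run A s c)
  embed-run zero    c = refl
  embed-run (suc s) c = trans (cong (P′.run A s) (embed-step c)) (embed-run s (M.step A c))

  embed-result : ∀ c {b} → M.result c ≡ just b → P′.result (embed c) ≡ just b
  embed-result (M.config q T) e with M.program q
  ... | halt _ = e

  on-word : ∀ x → x ≡ w → ∃[ s ] s ≤ probeTime (length x) × P′.result (P′.run A s (P′.initial [ x ])) ≡ just b
  on-word x x≡w =
    let ok , r , iff = recognize⇒ x
    in P.answer A r [ x ] refl (cong (tail ∘ exit) (Equivalence.from iff x≡w))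

  off-word : ∀ x → ¬ x ≡ w → ∀ s {b′} → M.result (M.run A s (M.initial [ x ])) ≡ just b′ →
    ∃[ s′ ] s′ ≤ probeTime (length x) + s × P′.result (P′.run A s′ (P′.initial [ x ])) ≡ just b′
  off-word x x≢w s {b′} e =
    let ok , r , iff = recognize⇒ x
        s₁ , s₁≤ , q≡ , T≈ = P.handover A r [ x ] refl
        q≡′ = trans q≡ (cong (inj₂ ∘ exit) (Bool.¬-not (x≢w ∘ Equivalence.to iff)))
        -- The restored tapes agree with the initial tapes of M only up to blanks.
        rest≋ = run-cong patched A s {c′ = embed (M.initial [ x ])} (q≡′ , T≈)
    in s₁ + s , +-monoˡ-≤ s s₁≤ , (begin
         P′.result (P′.run A (s₁ + s) (P′.initial [ x ]))
           ≡⟨ cong P′.result (run-+ patched A s₁ s (P′.initial [ x ])) ⟩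
         P′.result (P′.run A s (P′.run A s₁ (P′.initial [ x ])))
           ≡⟨ cong (λ q → P′.verdict (P′.program q)) (proj₁ rest≋) ⟩
         P′.result (P′.run A s (embed (M.initial [ x ])))
           ≡⟨ cong P′.result (embed-run s (M.initial [ x ])) ⟩
         P′.result (embed (M.run A s (M.initial [ x ])))
           ≡⟨ embed-result (M.run A s (M.initial [ x ])) e ⟩
         just b′ ∎)
    where open ≡-Reasoning

  patched-polyTime : PolyTime M A → PolyTime patched A
  patched-polyTime (p , halts) = polyTime patched A
    (poly-+ {λ n → probeTime n} {⟦ p ⟧} (poly-+ (poly-const (length w + 1))
      (poly-+ (poly-* poly-id (poly-const 2)) (poly-const 3))) (p , λ _ → refl))
    (λ { (x ∷ []) → halts-at x (List.≡-dec Bool._≟_ x w) })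
    where
    probeTime≤ : ∀ x → probeTime (length x) ≤ probeTime (length x + 0)
    probeTime≤ x = ≤-reflexive (cong probeTime (sym (+-identityʳ (length x))))

    halts-at : ∀ x → Dec (x ≡ w) → let N = length x + 0 in
      ∃[ s ] s ≤ probeTime N + ⟦ p ⟧ N × ∃[ b ] P′.result (P′.run A s (P′.initial [ x ])) ≡ just b
    halts-at x (yes x≡w) =
      let s , s≤ , r≡ = on-word x x≡w
      in s , ≤-trans s≤ (≤-trans (probeTime≤ x) (m≤m+n _ _)) , b , r≡
    halts-at x (no x≢w) =
      let b′ , e = halts⇒result M A {⟦ p ⟧ (length x + 0)} (halts [ x ])
          s , s≤ , r≡ = off-word x x≢w (⟦ p ⟧ (length x + 0)) e
      in s , ≤-trans s≤ (+-monoˡ-≤ _ (probeTime≤ x)) , b′ , r≡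

  patched-correct : ∀ {Q} → Q w ≡ b → ∀ x → x ≡ w ⊎ CorrectAt M A Q x → CorrectAt patched A Q x
  patched-correct {Q} Qw x = correct (List.≡-dec Bool._≟_ x w)
    where
    correct : Dec (x ≡ w) → x ≡ w ⊎ CorrectAt M A Q x → CorrectAt patched A Q x
    correct (yes x≡w) _              =
      let s , _ , r≡ = on-word x x≡w in s , trans r≡ (cong just (sym (trans (cong Q x≡w) Qw)))
    correct (no x≢w)  (inj₁ x≡w)     = contradiction x≡w x≢w
    correct (no x≢w)  (inj₂ (s , e)) = let s′ , _ , r≡ = off-word x x≢w s e in s′ , r≡

-- From almost everywhere correct machines to membership in P

words-complete : ∀ x → x ∈ˡ words (length x)
words-complete []          = hereˡ refl
words-complete (false ∷ x) = ∈-++⁺ˡ (∈-map⁺ (false ∷_) (words-complete x))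
words-complete (true ∷ x)  = ∈-++⁺ʳ (map (false ∷_) (words (length x))) (∈-map⁺ (true ∷_) (words-complete x))

module _ {A Q : Language} where

  patchAll : ∀ ws M → PolyTime M A → Σ (Machine 1) λ M′ → PolyTime M′ A ×
    (∀ x → x ∈ˡ ws ⊎ CorrectAt M A Q x → CorrectAt M′ A Q x)
  patchAll []       M poly = M , poly , λ { x (inj₂ c) → c }
  patchAll (w ∷ ws) M poly =
    let M′ , poly′ , fixes = patchAll ws M poly
        open Patch M′ A w (Q w)
    in patched , patched-polyTime poly′ , λ
      { x (inj₁ (hereˡ x≡w))  → patched-correct refl x (inj₁ x≡w)
      ; x (inj₁ (thereˡ x∈)) → patched-correct refl x (inj₂ (fixes x (inj₁ x∈)))
      ; x (inj₂ c)            → patched-correct refl x (inj₂ (fixes x (inj₂ c)))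
      }

  -- Lowers the threshold one length at a time, hard-wiring the answers for all words of that
  -- length.
  almost-correct⇒∈P : ∀ N M → PolyTime M A → (∀ x → N ≤ length x → CorrectAt M A Q x) → Q ∈ P[ A ]
  almost-correct⇒∈P zero    M poly correct = M , poly , λ x → correct x z≤n
  almost-correct⇒∈P (suc N) M poly correct =
    let M′ , poly′ , fixes = patchAll (words N) M poly
    in almost-correct⇒∈P N M′ poly′ λ x N≤ → fixes x (short-or-long x (m≤n⇒m<n∨m≡n N≤))
    where
    short-or-long : ∀ x → N < length x ⊎ N ≡ length x → x ∈ˡ words N ⊎ CorrectAt M A Q x
    short-or-long x (inj₁ N<)   = inj₂ (correct x N<)
    short-or-long x (inj₂ refl) = inj₁ (words-complete x)

-- Membership of the complement in NP

≡true-⇔-dec : ∀ {P Q : Set} (P? : Dec P) → ((¬ P) ⇔ Q) → not (does P?) ≡ true ⇔ Q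
≡true-⇔-dec (yes p) iff = mk⇔ (λ ()) (λ q → contradiction p (Equivalence.from iff q))
≡true-⇔-dec (no ¬p) iff = mk⇔ (λ _ → Equivalence.to iff ¬p) (λ _ → refl)

module _ (d : ℕ) (V : Machine 1) (L : Language) (t : Poly) where
  open Complexity d V L t

  -- The product has the order in which the verifier spends it: d units for each effective round.
  Short : Word → Word → Set
  Short x y = length y + ⌈log₂ length x ⌉ * d < length x

  -- A negated statement yields no program by itself; the bounded search up to |x| supplies one,
  -- since without a program shorter than |x| the word would lie in R̂.
  ¬R̂-⇔ : ∀ x → (¬ R̂ x) ⇔ (∃[ y ] Produces y x × Short x y)
  ¬R̂-⇔ x = mk⇔ compressible incompressible
    where
    order : ∀ k → k + ⌈log₂ length x ⌉ * d ≡ k + d * ⌈log₂ length x ⌉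
    order k = cong (k +_) (*-comm ⌈log₂ length x ⌉ d)

    compressible : ¬ R̂ x → ∃[ y ] Produces y x × Short x y
    compressible ¬r with search x (length x)
    ... | inj₁ none = contradiction
      (λ { k ((p , refl , h) , _) → ≤-trans (none p h) (m≤m+n _ _) }) ¬r
    ... | inj₂ (k , isK@((p , refl , h) , least)) = p , h , ≰⇒> λ le → ¬r λ
      { k′ ((p′ , refl , h′) , least′) → ≤-trans le
          (subst (_≤ length p′ + d * ⌈log₂ length x ⌉) (sym (order (length p)))
            (+-monoˡ-≤ _ (least p′ h′))) }

    incompressible : ∃[ y ] Produces y x × Short x y → ¬ R̂ x
    incompressible (y , h , short) r with search x (length x)
    ... | inj₁ none = <⇒≱ short (≤-trans (none y h) (m≤m+n _ _))
    ... | inj₂ (k , isK@(_ , least)) = <⇒≱ short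
      (≤-trans (r k isK) (≤-trans (+-monoˡ-≤ _ (least y h)) (≤-reflexive (sym (order (length y))))))

  coQ-⇔ : ∀ x → co Q x ≡ true ⇔ (∃[ y ] Produces y x × Short x y)
  coQ-⇔ x = ≡true-⇔-dec (R̂? x) (¬R̂-⇔ x)

  open Verifier d V L t
  private module V = Machine V

  module W = Assemble {2} {w + m}
    (×-finite (V.size , V.finite) (×-finite Bool-finite Bool-finite)) Bool-finite
    (jv V.queryTape) (jv V.outTape) verify (V.start , false , false) (proj₂ ∘ proj₂) halt

  verifier : Machine 2
  verifier = W.machine

  verdict⇒ : ∀ x y → ∃[ β ] ∃[ s ] s ≤ verifyTime (length x) (length y) ×
    Machine.result verifier (Machine.run verifier (co L) s (Machine.initial verifier (x ∷ y ∷ []))) ≡ just β ×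
    (β ≡ true ⇔ (Produces y x × Short x y))
  verdict⇒ x y =
    let q , β , T , run , iff = verify⇒ x y
        s , s≤ , r≡ = W.answer (co L) run (x ∷ y ∷ [])
          (cong (λ ts → load x ∷ load y ∷ ts) (replicate-+ w m blankTape)) refl
    in β , s , s≤ , r≡ , iff

  clockTime-mono : ∀ p {n n′} → n ≤ n′ → clockTime p n ≤ clockTime p n′
  clockTime-mono []      n≤ = ≤-refl
  clockTime-mono (a ∷ p) n≤ = +-monoʳ-≤ (a * 1 + 1) (eachTime-mono n≤ (clockTime-mono p n≤))

  -- `PolyTime` measures the sum of the input lengths, so both arguments are raised to that sum.
  verifyTime-mono : ∀ {n n′ l l′} → n ≤ n′ → l ≤ l′ → verifyTime n l ≤ verifyTime n′ l′
  verifyTime-mono n≤ l≤ =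
    +-mono-≤ (+-mono-≤ (eachTime-mono {τ = 1} n≤ ≤-refl) (eachTime-mono {τ = 1} n≤ ≤-refl))
    (+-mono-≤ (eachTime-mono {τ = 1} l≤ ≤-refl)
    (+-mono-≤ (eachTime-mono n≤ (s≤s (+-monoˡ-≤ (d * 1 + 1) (eachTime-mono {τ = 1} n≤ ≤-refl))))
    (+-mono-≤ (clockTime-mono t n≤)
              (+-monoˡ-≤ 1 (+-monoˡ-≤ 1 (+-mono-≤ (*-monoˡ-≤ 2 n≤) n≤))))))

  poly-clockTime : ∀ p → IsPoly (clockTime p)
  poly-clockTime []      = poly-const 1
  poly-clockTime (a ∷ p) = poly-+ (poly-const (a * 1 + 1)) (poly-eachTime (poly-clockTime p))

  poly-verifyTime : IsPoly (λ n → verifyTime n n)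
  poly-verifyTime =
    poly-+ (poly-+ pass-time pass-time)
    (poly-+ pass-time
    (poly-+ (poly-eachTime (poly-+ (poly-const 1) (poly-+ pass-time (poly-const (d * 1 + 1)))))
    (poly-+ (poly-clockTime t)
            (poly-+ (poly-+ (poly-+ (poly-* poly-id (poly-const 2)) poly-id) (poly-const 1))
                    (poly-const 1)))))
    where
    pass-time : IsPoly (λ n → eachTime n 1)
    pass-time = poly-eachTime (poly-const 1)

  verifier-polyTime : PolyTime verifier (co L)
  verifier-polyTime = polyTime verifier (co L) poly-verifyTime halts
    where
    halts : ∀ xs → ∃[ s ] s ≤ verifyTime (Vec.sum (Vec.map length xs)) (Vec.sum (Vec.map length xs)) ×
      ∃[ β ] Machine.result verifier (Machine.run verifier (co L) s (Machine.initial verifier xs)) ≡ just β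
    halts (x ∷ y ∷ []) =
      let β , s , s≤ , r≡ , _ = verdict⇒ x y
      in s , ≤-trans s≤ (verifyTime-mono {length x} {length x + (length y + 0)}
                           (m≤m+n (length x) _)
                           (≤-trans (m≤m+n (length y) 0) (m≤n+m _ (length x)))) , β , r≡

  coQ∈NP : co Q ∈ NP[ co L ]
  -- The witness bound is the identity polynomial, as `Short` forces |y| < |x|.
  coQ∈NP = verifier , verifier-polyTime , (0 ∷ 1 ∷ []) , λ x → mk⇔ (to x) (from x)
    where
    to : ∀ x → co Q x ≡ true → ∃[ y ] length y ≤ ⟦ 0 ∷ 1 ∷ [] ⟧ (length x) ×
                                 Answers verifier (co L) (x ∷ y ∷ []) true
    to x e =
      let y , h , short        = Equivalence.to (coQ-⇔ x) e
          β , s , _ , r≡ , iff = verdict⇒ x y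
      in y , ≤-trans (m≤m+n (length y) _) (≤-trans (<⇒≤ short) (≤-reflexive (proj₂ poly-id (length x)))) ,
         s , trans r≡ (cong just (Equivalence.from iff (h , short)))

    from : ∀ x → ∃[ y ] length y ≤ ⟦ 0 ∷ 1 ∷ [] ⟧ (length x) ×
                   Answers verifier (co L) (x ∷ y ∷ []) true → co Q x ≡ true
    from x (y , _ , s′ , r≡′) =
      let β , s , _ , r≡ , iff = verdict⇒ x y
      in Equivalence.from (coQ-⇔ x) (y , Equivalence.to iff
           -- Acceptance is given at an arbitrary time s′, whereas `iff` concerns the run of length
           -- s.
           (run-result-unique verifier (co L) s s′ {Machine.initial verifier (x ∷ y ∷ [])} r≡ r≡′))

-- Density

-- Delete the head of xs from ys: by uniqueness the other elements of xs survive the deletion.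
unique-⊆-length : ∀ {A : Set} {xs ys : List A} → Unique xs → (∀ {x} → x ∈ˡ xs → x ∈ˡ ys) →
                  length xs ≤ length ys
unique-⊆-length {xs = []}     []           sub = z≤n
unique-⊆-length {xs = x ∷ xs} (fresh ∷ un) sub with as , bs , refl ← ∈-∃++ (sub (hereˡ refl)) =
  subst (suc (length xs) ≤_) (sym len) (s≤s (unique-⊆-length un others))
  where
  len : length (as ++ x ∷ bs) ≡ suc (length (as ++ bs))
  len = List.length-++-sucʳ as x bs
  others : ∀ {z} → z ∈ˡ xs → z ∈ˡ as ++ bs
  others z∈ with ∈-++⁻ as (sub (thereˡ z∈))
  ... | inj₁ z∈as           = ∈-++⁺ˡ z∈as
  ... | inj₂ (hereˡ refl)   = contradiction refl (All.lookup fresh z∈)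
  ... | inj₂ (thereˡ z∈bs) = ∈-++⁺ʳ as z∈bs

filter-split : ∀ {A : Set} (p : A → Bool) xs →
               length (filterᵇ p xs) + length (filterᵇ (not ∘ p) xs) ≡ length xs
filter-split p []       = refl
filter-split p (x ∷ xs) with p x
... | true  = cong suc (filter-split p xs)
... | false = trans (+-suc _ _) (cong suc (filter-split p xs))

length-words : ∀ n → length (words n) ≡ 2 ^ n
length-words zero    = refl
length-words (suc n) = begin
  length (map (false ∷_) (words n) ++ map (true ∷_) (words n)) ≡⟨ List.length-++ (map (false ∷_) (words n)) ⟩
  length (map (false ∷_) (words n)) + length (map (true ∷_) (words n))
    ≡⟨ cong₂ _+_ (List.length-map _ (words n)) (List.length-map _ (words n)) ⟩
  length (words n) + length (words n) ≡⟨ cong (λ l → l + l) (length-words n) ⟩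
  2 ^ n + 2 ^ n ≡⟨ cong (λ l → 2 ^ n + l) (+-identityʳ (2 ^ n)) ⟨
  2 ^ suc n ∎
  where open ≡-Reasoning

words-length : ∀ n {x} → x ∈ˡ words n → length x ≡ n
words-length zero    (hereˡ refl) = refl
words-length (suc n) x∈ with ∈-++⁻ (map (false ∷_) (words n)) x∈
... | inj₁ x∈₀ with _ , v∈ , refl ← ∈-map⁻ (false ∷_) x∈₀ = cong suc (words-length n v∈)
... | inj₂ x∈₁ with _ , v∈ , refl ← ∈-map⁻ (true ∷_) x∈₁  = cong suc (words-length n v∈)

words-unique : ∀ n → Unique (words n)
words-unique zero    = All.[] ∷ []
words-unique (suc n) = Unique.++⁺ (Unique.map⁺ List.∷-injectiveʳ (words-unique n))
                                  (Unique.map⁺ List.∷-injectiveʳ (words-unique n)) disjoint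
  where
  disjoint : ∀ {x} → ¬ (x ∈ˡ map (false ∷_) (words n) × x ∈ˡ map (true ∷_) (words n))
  disjoint (x∈₀ , x∈₁) with _ , _ , refl ← ∈-map⁻ (false ∷_) x∈₀ with _ , _ , () ← ∈-map⁻ (true ∷_) x∈₁

wordsBelow : ℕ → List Word
wordsBelow zero    = []
wordsBelow (suc b) = wordsBelow b ++ words b

-- The geometric sum 1 + 2 + ... + 2^(b-1) = 2^b - 1, free of subtraction.
length-wordsBelow : ∀ b → suc (length (wordsBelow b)) ≡ 2 ^ b
length-wordsBelow zero    = refl
length-wordsBelow (suc b) = begin
  suc (length (wordsBelow b ++ words b))             ≡⟨ cong suc (List.length-++ (wordsBelow b)) ⟩
  suc (length (wordsBelow b)) + length (words b)     ≡⟨ cong₂ _+_ (length-wordsBelow b) (length-words b) ⟩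
  2 ^ b + 2 ^ b                                      ≡⟨ cong (λ l → 2 ^ b + l) (+-identityʳ (2 ^ b)) ⟨
  2 ^ suc b                                          ∎
  where open ≡-Reasoning

wordsBelow-complete : ∀ b y → length y < b → y ∈ˡ wordsBelow b
wordsBelow-complete (suc b) y (s≤s y≤b) with m≤n⇒m<n∨m≡n y≤b
... | inj₁ y<b  = ∈-++⁺ˡ (wordsBelow-complete b y y<b)
... | inj₂ refl = ∈-++⁺ʳ (wordsBelow b) (words-complete y)

module _ (d : ℕ) (V : Machine 1) (L : Language) (t : Poly) where
  open Complexity d V L t
  open Machine V using (output; run; initial)

  compressibles : ℕ → List Word
  compressibles n = filterᵇ (co Q) (words n)

  -- Since the clock is fixed by n, `decode` is one function of the program, and its image on the
  -- short programs contains every compressible word.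
  compressibles-few : ∀ n → length (compressibles n) ≤ length (wordsBelow (n ∸ ⌈log₂ n ⌉ * d))
  compressibles-few n = subst (length (compressibles n) ≤_) (List.length-map decode programs)
    (unique-⊆-length (Unique.filter⁺ (Bool.T? ∘ co Q) (words-unique n)) decoded)
    where
    decode : Word → Word
    decode y = output (run L (⟦ t ⟧ n) (initial [ y ]))
    programs : List Word
    programs = wordsBelow (n ∸ ⌈log₂ n ⌉ * d)
    decoded : ∀ {x} → x ∈ˡ compressibles n → x ∈ˡ map decode programs
    decoded {x} x∈ with x∈words , ¬Q ← ∈-filter⁻ (Bool.T? ∘ co Q) {xs = words n} x∈
      with refl ← words-length n x∈words
      with y , (_ , out) , short ← Equivalence.to (coQ-⇔ d V L t x) (Equivalence.to Bool.T-≡ ¬Q) =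
      subst (_∈ˡ map decode programs) out
        (∈-map⁺ decode (wordsBelow-complete _ y (m+n≤o⇒m≤o∸n (suc (length y)) short)))

  compressibles-sparse : ∀ n → length (compressibles n) * n ^ d ≤ 2 ^ n
  compressibles-sparse n with ⌈log₂ n ⌉ * d ≤? n
  ... | yes kd≤n = begin
    length (compressibles n) * n ^ d
      ≤⟨ *-mono-≤ (compressibles-few n) (^-monoˡ-≤ d (n≤2^⌈log₂n⌉ n)) ⟩
    length (wordsBelow b) * (2 ^ ⌈log₂ n ⌉) ^ d ≤⟨ *-monoˡ-≤ _ (n≤1+n (length (wordsBelow b))) ⟩
    suc (length (wordsBelow b)) * (2 ^ ⌈log₂ n ⌉) ^ d
      ≡⟨ cong₂ _*_ (length-wordsBelow b) (^-*-assoc 2 ⌈log₂ n ⌉ d) ⟩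
    2 ^ b * 2 ^ (⌈log₂ n ⌉ * d)                 ≡⟨ ^-distribˡ-+-* 2 b (⌈log₂ n ⌉ * d) ⟨
    2 ^ (b + ⌈log₂ n ⌉ * d)                     ≡⟨ cong (2 ^_) (m∸n+n≡m kd≤n) ⟩
    2 ^ n                                       ∎
    where
    open ≤-Reasoning
    b = n ∸ ⌈log₂ n ⌉ * d
  -- Here the truncated difference is 0, so there are no short enough programs and nothing is
  -- compressible.
  ... | no kd≰n = subst (λ l → l * n ^ d ≤ 2 ^ n) (sym none) z≤n
    where
    none : length (compressibles n) ≡ 0
    none = n≤0⇒n≡0 (subst (λ b → length (compressibles n) ≤ length (wordsBelow b))
      (m≤n⇒m∸n≡0 (<⇒≤ (≰⇒> kd≰n))) (compressibles-few n))

  count-Q : ∀ n → length (filterᵇ Q (words n)) + length (compressibles n) ≡ 2 ^ n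
  count-Q n = trans (filter-split Q (words n)) (length-words n)

-- Rational form of the density bound

1-fraction : ∀ g b P .{{_ : NonZero P}} → g + b ≡ P → 1ℚᵘ ℚ.- (ℤ.+ b) ℚ./ P ℚ.≤ (ℤ.+ g) ℚ./ P
1-fraction g b (suc p) e = *≤* (ℤ.≤-reflexive eq)
  where
  P = suc p
  arith : ∀ g b → (ℤ.1ℤ ℤ.* (g ℤ.+ b) ℤ.+ ℤ.- b ℤ.* ℤ.1ℤ) ℤ.* (g ℤ.+ b) ≡ g ℤ.* (g ℤ.+ b)
  arith = ℤ-Solver.solve-∀
  sum≡ : ℤ.+ P ≡ ℤ.+ g ℤ.+ ℤ.+ b
  sum≡ = trans (cong ℤ.+_ (sym e)) (ℤ.pos-+ g b)
  -- The identity 1 - b/P = g/P cross-multiplied; unnormalised subtraction leaves the denominator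
  -- `1 * P`.
  eq : (ℤ.1ℤ ℤ.* ℤ.+ P ℤ.+ ℤ.- (ℤ.+ b) ℤ.* ℤ.1ℤ) ℤ.* ℤ.+ P ≡ ℤ.+ g ℤ.* ℤ.+ (1 * P)
  eq = begin
    (ℤ.1ℤ ℤ.* ℤ.+ P ℤ.+ ℤ.- (ℤ.+ b) ℤ.* ℤ.1ℤ) ℤ.* ℤ.+ P
      ≡⟨ cong (λ P → (ℤ.1ℤ ℤ.* P ℤ.+ ℤ.- (ℤ.+ b) ℤ.* ℤ.1ℤ) ℤ.* P) sum≡ ⟩
    _                           ≡⟨ arith (ℤ.+ g) (ℤ.+ b) ⟩
    ℤ.+ g ℤ.* (ℤ.+ g ℤ.+ ℤ.+ b) ≡⟨ cong (ℤ.+ g ℤ.*_) sum≡ ⟨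
    ℤ.+ g ℤ.* ℤ.+ P             ≡⟨ cong (λ P → ℤ.+ g ℤ.* ℤ.+ P) (*-identityˡ P) ⟨
    ℤ.+ g ℤ.* ℤ.+ (1 * P)       ∎
    where open ≡-Reasoning

fraction-≤ : ∀ b P D .{{_ : NonZero P}} .{{_ : NonZero D}} → b * D ≤ P → (ℤ.+ b) ℚ./ P ℚ.≤ (ℤ.+ 1) ℚ./ D
fraction-≤ b (suc p) (suc e) le =
  *≤* (subst₂ ℤ._≤_ (ℤ.pos-* b (suc e)) (sym (ℤ.*-identityˡ (ℤ.+ suc p))) (ℤ.+≤+ le))

1-antimono-≤ : ∀ {p q} → p ℚ.≤ q → 1ℚᵘ ℚ.- q ℚ.≤ 1ℚᵘ ℚ.- p
1-antimono-≤ p≤q = ℚ.+-monoʳ-≤ 1ℚᵘ (ℚ.neg-mono-≤ p≤q)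

-- The number ε = (a+1)/(e+1) is at least 1/(e+1), and n ≤ n^d for positive d, so N = e + 1 works
-- and makes n nonzero.
1/-small : ∀ d → 1 ≤ d → ∀ ε → 0ℚᵘ ℚ.< ε →
           ∃[ N ] ∀ n → N ≤ n → Σ (NonZero n) λ nz → (1/ n ^ d) {{nz}} ℚ.≤ ε
1/-small (suc d) _ (mkℚᵘ (ℤ.+ zero) e)    (*<* (ℤ.+<+ ()))
1/-small (suc d) _ (mkℚᵘ (ℤ.+ suc a) e) _ = suc e , λ { n@(suc _) e<n →
    _ , bound (n ^ suc d) {{m^n≢0 n (suc d)}} (≤-trans e<n (power≥ n)) }
  where
  power≥ : ∀ n .{{_ : NonZero n}} → n ≤ n ^ suc d
  power≥ n = m≤m*n n (n ^ d) {{m^n≢0 n d}}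
  bound : ∀ D .{{_ : NonZero D}} → suc e ≤ D → (ℤ.+ 1) ℚ./ D ℚ.≤ mkℚᵘ (ℤ.+ suc a) e
  bound D@(suc _) le = *≤* (subst₂ ℤ._≤_ (sym (ℤ.*-identityˡ (ℤ.+ suc e))) (ℤ.pos-* (suc a) D)
    (ℤ.+≤+ (≤-trans le (m≤n*m D (suc a)))))

module _ (d : ℕ) (V : Machine 1) (L : Language) (t : Poly) where
  open Complexity d V L t

  density-Q : ∀ n .{{_ : NonZero n}} → 1ℚᵘ ℚ.- 1/ n ^ d ℚ.≤ density Q n
  density-Q n = ℚ.≤-trans
    (1-antimono-≤ (fraction-≤ (length (compressibles d V L t n)) (2 ^ n) (n ^ d)
      (compressibles-sparse d V L t n)))
    (1-fraction _ _ (2 ^ n) (count-Q d V L t n))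
    where instance
      _ = m^n≢0 2 n
      _ = m^n≢0 n d

  density-Q→1 : 1 ≤ d → ∀ ε → 0ℚᵘ ℚ.< ε → ∃[ N ] ∀ n → N ≤ n → 1ℚᵘ ℚ.- ε ℚ.≤ density Q n
  density-Q→1 1≤d ε 0<ε =
    let N , small = 1/-small d 1≤d ε 0<ε
    in N , λ n N≤n → let nz , small-n = small n N≤n in
         ℚ.≤-trans (1-antimono-≤ small-n) (density-Q n {{nz}})

theorem3p18 : (d : ℕ) → 3 ≤ d →
    (L : ℕ → Language) → (∀ i → 1 ≤ i → Complete (Πᵖ i) (L i)) →
    (V : ℕ → Machine 1) → (∀ i → 1 ≤ i → Universal (V i) (L i)) →
    (seth : SETH-K-PH d L V) →
    ∀ i (1≤i : 1 ≤ i) →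
    let open Complexity d (V i) (L i) (proj₁ (seth i 1≤i)) in
    (Q ∈ Πᵖ (suc i) × Q ∉ P^ (Πᵖ i) × Q ∉ Πᵖ i × ¬ (Πᵖ i ≐ Πᵖ (suc i)))
    ×
    ((∀ n .{{_ : NonZero n}} → 1ℚᵘ ℚ.- 1/ n ^ d ℚ.≤ density Q n)
    × (∀ ε → 0ℚᵘ ℚ.< ε → ∃[ N ] ∀ n → N ≤ n → 1ℚᵘ ℚ.- ε ℚ.≤ density Q n))
    ×
    (ExcludedMiddle 0ℓ →
    ∀ (A : Language) → A ∈ Πᵖ i → ∀ (M : Machine 1) → PolyTime M A →
    (∃[ N ] ∀ n → N ≤ n → ∀ x → length x ≡ n → R̂ x → CorrectAt M A Q x) →
    ∀ N → ∃[ n ] N ≤ n × ∃[ x ] length x ≡ n × ¬ R̂ x × ¬ CorrectAt M A Q x)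
theorem3p18 d 3≤d L complete V universal seth i 1≤i =
  (Q∈Π , Q∉P^ , Q∉Π , λ (_ , collapse) → Q∉Π (collapse Q∈Π)) ,
  (density-Q d (V i) (L i) t , density-Q→1 d (V i) (L i) t (≤-trans (s≤s z≤n) 3≤d)) ,
  errs
  where
  t = proj₁ (seth i 1≤i)
  open Complexity d (V i) (L i) t

  Q∉P^ : Q ∉ P^ (Πᵖ i)
  Q∉P^ = proj₂ (seth i 1≤i)

  Q∈Π : Q ∈ Πᵖ (suc i)
  -- `L i ∈ Πᵖ i` is by definition `co (L i) ∈ Σᵖ i`, so `co (L i)` is an admissible oracle.
  Q∈Π = co (L i) , proj₁ (complete i 1≤i) , coQ∈NP d (V i) (L i) t

  Q∉Π : Q ∉ Πᵖ i
  Q∉Π Q∈ = Q∉P^ (Q , Q∈ , oracle∈P Q)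

  -- The assumption only refutes membership, so the error is obtained by contradiction: `em` decides
  -- whether one exists beyond N, and whether M is correct at a given word.
  errs : ExcludedMiddle 0ℓ → ∀ A → A ∈ Πᵖ i → ∀ M → PolyTime M A →
    (∃[ N ] ∀ n → N ≤ n → ∀ x → length x ≡ n → R̂ x → CorrectAt M A Q x) →
    ∀ N → ∃[ n ] N ≤ n × ∃[ x ] length x ≡ n × ¬ R̂ x × ¬ CorrectAt M A Q x
  errs em A A∈Π M poly (N₀ , correct) N with em
  ... | yes error  = error
  ... | no ¬error = contradiction
    (A , A∈Π , almost-correct⇒∈P (N ⊔ N₀) M poly correct-beyond) Q∉P^
    where
    correct-at : ∀ x → N ⊔ N₀ ≤ length x → Dec (R̂ x) → Dec (CorrectAt M A Q x) → CorrectAt M A Q x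
    correct-at x long _        (yes c) = c
    correct-at x long (yes r) _        = correct (length x) (≤-trans (m≤n⊔m N N₀) long) x refl r
    correct-at x long (no ¬r) (no ¬c) =
      contradiction (length x , ≤-trans (m≤m⊔n N N₀) long , x , refl , ¬r , ¬c) ¬error

    correct-beyond : ∀ x → N ⊔ N₀ ≤ length x → CorrectAt M A Q x
    correct-beyond x long = correct-at x long (R̂? x) em
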